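{- The only $B4$-collinear integers are $1$, $2$, and $5$. That is, a positive integer $k$ is $B4$-collinear if and only if $k\in\{1,2,5\}$.
   Context: A lattice triangle is a (non-degenerate) triangle in the plane whose three vertices lie in $\mathbb{Z}^2$. Its boundary points are the points of $\mathbb{Z}^2$ on its boundary (vertices included), and its interior points are the points of $\mathbb{Z}^2$ in its topological interior. For a positive integer $n$, a positive integer $k$ is called $Bn$-collinear if (i) there exists at least one lattice triangle with exactly $n$ boundary points and exactly $k$ interior points, and (ii) for every lattice triangle with exactly $n$ boundary points and exactly $k$ interior points, the $k$ interior points all lie on a common line. -}

module Defs where

open import Level using (0ℓ)
open import Data.Nat.Base using (ℕ)
open import Data.Integer.Base using (ℤ)
open import Data.Rational.Base using (ℚ; 0ℚ; 1ℚ; _+_; _-_; _*_; _/_; ∣_∣; _≤_; _<_)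
open import Data.List.Base using (List; length)
open import Data.List.Membership.Propositional using (_∈_)
open import Data.List.Relation.Unary.Unique.Propositional using (Unique)
open import Data.Product.Base using (_×_; _,_; ∃-syntax; Σ-syntax)
open import Data.Sum.Base using (_⊎_)
open import Function.Bundles using (_⇔_)
open import Relation.Nullary.Negation.Core using (¬_)
open import Relation.Unary using (Pred)
open import Relation.Binary.PropositionalEquality.Core using (_≡_)

-- The plane is modelled by ℚ².  All vertices below are lattice points, and a
-- rational point of a real segment, triangle or triangle interior with rational
-- vertices has rational convex coefficients, so the lattice points of the sets
-- defined here are the same as over ℝ.
Plane : Set
Plane = ℚ × ℚ

Lattice : Set
Lattice = ℤ × ℤ

ι : Lattice → Plane
ι (x , y) = (x / 1) , (y / 1)

infixl 6 _⊕_
infixl 7 _·_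

_⊕_ : Plane → Plane → Plane
(x₁ , y₁) ⊕ (x₂ , y₂) = (x₁ + x₂) , (y₁ + y₂)

_·_ : ℚ → Plane → Plane
r · (x , y) = (r * x) , (r * y)

Segment : Plane → Plane → Pred Plane 0ℓ
Segment A B P =
  ∃[ s ] ∃[ t ] (0ℚ ≤ s × 0ℚ ≤ t × s + t ≡ 1ℚ × P ≡ s · A ⊕ t · B)

Hull₃ : Plane → Plane → Plane → Pred Plane 0ℓ
Hull₃ A B C P =
  ∃[ s ] ∃[ t ] ∃[ u ] (0ℚ ≤ s × 0ℚ ≤ t × 0ℚ ≤ u ×
    s + t + u ≡ 1ℚ × P ≡ s · A ⊕ t · B ⊕ u · C)

-- Topological interior; open boxes form a basis of the Euclidean topology.
Interior : Pred Plane 0ℓ → Pred Plane 0ℓ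
Interior S (x , y) =
  ∃[ ε ] (0ℚ < ε × (∀ x′ y′ → ∣ x′ - x ∣ < ε → ∣ y′ - y ∣ < ε → S (x′ , y′)))

record Line : Set where
  field
    a b c      : ℚ
    nontrivial : ¬ (a ≡ 0ℚ × b ≡ 0ℚ)

OnLine : Line → Pred Plane 0ℓ
OnLine ℓ (x , y) = a * x + b * y ≡ c
  where open Line ℓ

record LatticeTriangle : Set where
  field
    A B C         : Lattice
    nondegenerate : ¬ (Σ[ ℓ ∈ Line ] (OnLine ℓ (ι A) × OnLine ℓ (ι B) × OnLine ℓ (ι C)))

BoundaryPoint : LatticeTriangle → Pred Lattice 0ℓ
BoundaryPoint T P =
  Segment (ι A) (ι B) (ι P) ⊎ Segment (ι B) (ι C) (ι P) ⊎ Segment (ι C) (ι A) (ι P)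
  where open LatticeTriangle T

InteriorPoint : LatticeTriangle → Pred Lattice 0ℓ
InteriorPoint T P = Interior (Hull₃ (ι A) (ι B) (ι C)) (ι P)
  where open LatticeTriangle T

HasExactly : ℕ → Pred Lattice 0ℓ → Set
HasExactly n S =
  Σ[ ps ∈ List Lattice ] (Unique ps × length ps ≡ n × (∀ P → P ∈ ps ⇔ S P))

HasCounts : ℕ → ℕ → LatticeTriangle → Set
HasCounts n k T = HasExactly n (BoundaryPoint T) × HasExactly k (InteriorPoint T)

Collinear : Pred Lattice 0ℓ → Set
Collinear S = Σ[ ℓ ∈ Line ] (∀ P → S P → OnLine ℓ (ι P))

-- "k is Bn-collinear"; meant for positive n and k.
BCollinear : ℕ → ℕ → Set
BCollinear n k =
  (Σ[ T ∈ LatticeTriangle ] HasCounts n k T) ×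
  (∀ T → HasCounts n k T → Collinear (InteriorPoint T))

-- In a triangle with four boundary points one edge AB consists of two primitive steps and the other
-- two edges are primitive.  In unimodular coordinates its vertices are (0,0), (2,0), (x,h) with x and
-- x − 2 coprime to h, and the half-turn of the parallelogram completing the triangle along BC pairs
-- the lattice points so that each of the rows 0 < j < h accounts for exactly one interior point:
-- k = h − 1.  For h = 2, 3, 6 coprimality forces x ≡ 1 modulo h, and a shear moves all interior points
-- to one line.  For every other h ≥ 4 there is 2 ≤ y ≤ h − 2 with y² − 1 coprime to h, and the triangle
-- with x = y + 1 contains (1,1), (2,1) and (2,2).
module Submission where

open import Defs
open import Data.Nat.Base using (ℕ; NonZero)
open import Data.Sum.Base using (_⊎_)
open import Function.Bundles using (_⇔_)
open import Relation.Binary.PropositionalEquality.Core using (_≡_)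

open import Level using (0ℓ)
open import Data.Empty using (⊥; ⊥-elim)
open import Data.Fin.Base using (Fin; toℕ; fromℕ<)
open import Data.Fin.Patterns using (0F; 1F; 2F; 3F; 4F; 5F)
import Data.Fin.Properties as Fin
open import Data.Integer.Base as ℤ using (ℤ; +_; 0ℤ; 1ℤ)
open import Data.Integer.DivMod using (_%ℕ_; _/ℕ_; n%ℕd<d; a≡a%ℕn+[a/ℕn]*n)
import Data.Integer.Properties as ℤ
import Data.Integer.Tactic.RingSolver as ℤ-Ring
open import Data.List.Base using ([]; _∷_; _++_; map; tabulate)
open import Data.List.Membership.Propositional using (_∈_)
open import Data.List.Membership.Propositional.Properties
  using (∈-tabulate⁺; ∈-tabulate⁻; ∈-map⁺; ∈-map⁻; ∈-++⁺ˡ; ∈-++⁺ʳ; ∈-++⁻)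
open import Data.List.Membership.Propositional.Properties.WithK using (unique∧set⇒bag)
import Data.List.Properties as List
open import Data.List.Relation.Binary.BagAndSetEquality using (∼bag⇒↭)
open import Data.List.Relation.Binary.Permutation.Propositional.Properties using (↭-length)
import Data.List.Relation.Unary.Unique.Propositional.Properties as Unique
open import Data.Nat.Base as ℕ using (suc)
open import Data.Nat.Divisibility using (divides; 0∣⇒≡0)
open import Data.Nat.DivMod using (DivMod; _divMod_; result)
open import Data.Nat.GCD using (module GCD; module Bézout)
import Data.Nat.Properties as ℕ
import Data.Nat.Tactic.RingSolver as ℕ-Ring
open import Data.Product.Base using (_×_; _,_; ∃-syntax; Σ-syntax; proj₁; proj₂)
open import Data.Sum.Base using (inj₁; inj₂; [_,_]′)
open import Function.Base using (_∘_; case_of_)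
open import Function.Bundles using (mk⇔; Equivalence)
open import Function.Construct.Composition using (_⇔-∘_)
open import Function.Construct.Symmetry using (⇔-sym)
open import Relation.Binary.Definitions using (Tri; tri<; tri≈; tri>)
open import Relation.Binary.PropositionalEquality
  using (_≢_; refl; sym; trans; cong; cong₂; subst; subst₂; module ≡-Reasoning)
open import Relation.Nullary using (¬_; yes; no)
open import Relation.Nullary.Decidable using (_×-dec_)
open import Relation.Unary using (Pred)

open Equivalence using (to; from)

-- Every coprimality is kept as a Bézout relation: it passes through a change of coordinates by a
-- linear identity, and in the examples one polynomial identity settles a whole arithmetic
-- progression of h. With x = y + 1 the two conditions on the apex merge, since x (x - 2) = y² - 1.
-- If 3 does not divide h, then y = 2 gives y² - 1 = 3; if h is odd, y = 3 gives 8. If 6 divides h,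
-- then y² - 1 is coprime to 6 only when y is a multiple of 6, which is why h = 6 has no solution.
-- For larger such h, if 4 or 9 divides h, then h divides y² for y = h/2 or y = h/3, so y² - 1 ≡ -1;
-- otherwise h ≡ ±6 modulo 36, and y is (h ∓ 6)/3, a multiple of 12. Segments and the topological
-- interior live over ℚ; both are turned into integer conditions before any counting.

det : Lattice → Lattice → Lattice → ℤ
det (a₁ , a₂) (b₁ , b₂) (c₁ , c₂) =
  (b₁ ℤ.- a₁) ℤ.* (c₂ ℤ.- a₂) ℤ.- (b₂ ℤ.- a₂) ℤ.* (c₁ ℤ.- a₁)

shift : Lattice → ℤ → Lattice → Lattice
shift (a₁ , a₂) n (v₁ , v₂) = (a₁ ℤ.+ n ℤ.* v₁) , (a₂ ℤ.+ n ℤ.* v₂)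

infix 7 _∙_
_∙_ : Lattice → Lattice → ℤ
(u₁ , u₂) ∙ (v₁ , v₂) = u₁ ℤ.* v₁ ℤ.+ u₂ ℤ.* v₂

-- B − A is g times a primitive vector; primitivity is witnessed by a Bézout relation.
record Edge (A B : Lattice) (g : ℕ) : Set where
  constructor edge
  field
    dir dual : Lattice
    bézout   : dual ∙ dir ≡ 1ℤ
    end      : B ≡ shift A (+ g) dir

OnEdge : ∀ {A B g} → Edge A B g → Lattice → Set
OnEdge {A} {B} {g} e P = ∃[ n ] (0ℤ ℤ.≤ n × n ℤ.≤ + g × P ≡ shift A n (Edge.dir e))

-- From convexity over ℚ to integer conditions

module RationalGeometry where

  open import Data.Rational.Base as ℚ hiding (NonZero)
  open import Data.Rational.Properties
  open import Data.Rational.Unnormalised.Base as ℚᵘ using (mkℚᵘ; *≡*; *≤*; *<*)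
  import Data.Rational.Unnormalised.Properties as ℚᵘ
  open import Relation.Nullary.Decidable using (dec⇒maybe)
  import Tactic.RingSolver as RingSolver
  import Tactic.RingSolver.Core.AlmostCommutativeRing as ACR

  private
    ring : ACR.AlmostCommutativeRing 0ℓ 0ℓ
    ring = ACR.fromCommutativeRing +-*-commutativeRing λ x → dec⇒maybe (0ℚ ≟ x)

  module _ where
    open ℚᵘ.≃-Reasoning

    -- Passing to unnormalised fractions avoids reduction by the gcd; there the claim is an integer
    -- identity of cross products.
    /1-homo-+ : ∀ m n → (m ℤ.+ n) / 1 ≡ m / 1 + n / 1
    /1-homo-+ m n = toℚᵘ-injective (begin
      toℚᵘ ((m ℤ.+ n) / 1)            ≈⟨ toℚᵘ-fromℚᵘ (mkℚᵘ (m ℤ.+ n) 0) ⟩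
      mkℚᵘ (m ℤ.+ n) 0                ≈⟨ *≡* (num m n) ⟩
      mkℚᵘ m 0 ℚᵘ.+ mkℚᵘ n 0          ≈⟨ ℚᵘ.+-cong (toℚᵘ-fromℚᵘ (mkℚᵘ m 0)) (toℚᵘ-fromℚᵘ (mkℚᵘ n 0)) ⟨
      toℚᵘ (m / 1) ℚᵘ.+ toℚᵘ (n / 1)  ≈⟨ toℚᵘ-homo-+ (m / 1) (n / 1) ⟨
      toℚᵘ (m / 1 + n / 1)            ∎)
      where
      num : ∀ m n → (m ℤ.+ n) ℤ.* 1ℤ ≡ (m ℤ.* 1ℤ ℤ.+ n ℤ.* 1ℤ) ℤ.* 1ℤ
      num = ℤ-Ring.solve-∀

    /1-homo-* : ∀ m n → (m ℤ.* n) / 1 ≡ m / 1 * (n / 1)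
    /1-homo-* m n = toℚᵘ-injective (begin
      toℚᵘ ((m ℤ.* n) / 1)            ≈⟨ toℚᵘ-fromℚᵘ (mkℚᵘ (m ℤ.* n) 0) ⟩
      mkℚᵘ m 0 ℚᵘ.* mkℚᵘ n 0          ≈⟨ ℚᵘ.*-cong (toℚᵘ-fromℚᵘ (mkℚᵘ m 0)) (toℚᵘ-fromℚᵘ (mkℚᵘ n 0)) ⟨
      toℚᵘ (m / 1) ℚᵘ.* toℚᵘ (n / 1)  ≈⟨ toℚᵘ-homo-* (m / 1) (n / 1) ⟨
      toℚᵘ (m / 1 * (n / 1))          ∎)

    /1-homo-neg : ∀ m → (ℤ.- m) / 1 ≡ - (m / 1)
    /1-homo-neg m = toℚᵘ-injective (begin
      toℚᵘ ((ℤ.- m) / 1)     ≈⟨ toℚᵘ-fromℚᵘ (mkℚᵘ (ℤ.- m) 0) ⟩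
      ℚᵘ.- mkℚᵘ m 0          ≈⟨ ℚᵘ.-‿cong (toℚᵘ-fromℚᵘ (mkℚᵘ m 0)) ⟨
      ℚᵘ.- toℚᵘ (m / 1)      ≈⟨ toℚᵘ-homo‿- (m / 1) ⟨
      toℚᵘ (- (m / 1))       ∎)

    /1-homo-- : ∀ m n → (m ℤ.- n) / 1 ≡ m / 1 - n / 1
    /1-homo-- m n = trans (/1-homo-+ m (ℤ.- n)) (cong (λ z → m / 1 + z) (/1-homo-neg n))

    /1-injective : ∀ {m n} → m / 1 ≡ n / 1 → m ≡ n
    /1-injective {m} {n} eq = drop (fromℚᵘ-injective {mkℚᵘ m 0} {mkℚᵘ n 0} eq)
      where
      drop : mkℚᵘ m 0 ℚᵘ.≃ mkℚᵘ n 0 → m ≡ n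
      drop (*≡* e) = trans (sym (ℤ.*-identityʳ m)) (trans e (ℤ.*-identityʳ n))

  /1-mono-≤ : ∀ {m n} → m ℤ.≤ n → m / 1 ≤ n / 1
  /1-mono-≤ {m} {n} m≤n = toℚᵘ-cancel-≤
    (ℚᵘ.≤-respˡ-≃ (ℚᵘ.≃-sym (toℚᵘ-fromℚᵘ (mkℚᵘ m 0)))
      (ℚᵘ.≤-respʳ-≃ (ℚᵘ.≃-sym (toℚᵘ-fromℚᵘ (mkℚᵘ n 0)))
        (*≤* (ℤ.*-monoʳ-≤-nonNeg 1ℤ m≤n))))

  /1-mono-< : ∀ {m n} → m ℤ.< n → m / 1 < n / 1
  /1-mono-< {m} {n} m<n = toℚᵘ-cancel-<
    (ℚᵘ.<-respˡ-≃ (ℚᵘ.≃-sym (toℚᵘ-fromℚᵘ (mkℚᵘ m 0)))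
      (ℚᵘ.<-respʳ-≃ (ℚᵘ.≃-sym (toℚᵘ-fromℚᵘ (mkℚᵘ n 0)))
        (*<* (ℤ.*-monoʳ-<-pos 1ℤ m<n))))

  /1-cancel-≤ : ∀ {m n} → m / 1 ≤ n / 1 → m ℤ.≤ n
  /1-cancel-≤ {m} {n} le with m ℤ.≤? n
  ... | yes m≤n = m≤n
  ... | no  m≰n = ⊥-elim (<-irrefl refl (<-≤-trans (/1-mono-< (ℤ.≰⇒> m≰n)) le))

  /1-cancel-< : ∀ {m n} → m / 1 < n / 1 → m ℤ.< n
  /1-cancel-< {m} {n} lt with m ℤ.<? n
  ... | yes m<n = m<n
  ... | no  m≮n = ⊥-elim (<-irrefl refl (<-≤-trans lt (/1-mono-≤ (ℤ.≮⇒≥ m≮n))))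

  detℚ : Plane → Plane → Plane → ℚ
  detℚ (a₁ , a₂) (b₁ , b₂) (c₁ , c₂) = (b₁ - a₁) * (c₂ - a₂) - (b₂ - a₂) * (c₁ - a₁)

  det-ι : ∀ A B C → det A B C / 1 ≡ detℚ (ι A) (ι B) (ι C)
  det-ι (a₁ , a₂) (b₁ , b₂) (c₁ , c₂) =
    trans (/1-homo-- ((b₁ ℤ.- a₁) ℤ.* (c₂ ℤ.- a₂)) ((b₂ ℤ.- a₂) ℤ.* (c₁ ℤ.- a₁)))
      (cong₂ _-_
        (trans (/1-homo-* (b₁ ℤ.- a₁) (c₂ ℤ.- a₂)) (cong₂ _*_ (/1-homo-- b₁ a₁) (/1-homo-- c₂ a₂)))
        (trans (/1-homo-* (b₂ ℤ.- a₂) (c₁ ℤ.- a₁)) (cong₂ _*_ (/1-homo-- b₂ a₂) (/1-homo-- c₁ a₁))))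

  -- Rational inequalities and small perturbations

  0<* : ∀ {p q} → 0ℚ < p → 0ℚ < q → 0ℚ < p * q
  0<* {p} {q} 0<p 0<q = positive⁻¹ (p * q) {{pos*pos⇒pos p {{positive 0<p}} q {{positive 0<q}}}}

  0≤* : ∀ {p q} → 0ℚ ≤ p → 0ℚ ≤ q → 0ℚ ≤ p * q
  0≤* {p} {q} 0≤p 0≤q =
    nonNegative⁻¹ (p * q) {{nonNeg*nonNeg⇒nonNeg p {{nonNegative 0≤p}} q {{nonNegative 0≤q}}}}

  0<*-cancelˡ : ∀ {p q} → 0ℚ ≤ p → 0ℚ < p * q → 0ℚ < q
  0<*-cancelˡ {p} {q} 0≤p 0<pq =
    *-cancelˡ-<-nonNeg p {{nonNegative 0≤p}} (subst (_< p * q) (sym (*-zeroʳ p)) 0<pq)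

  p≤∣p∣ : ∀ p → p ≤ ∣ p ∣
  p≤∣p∣ p with ∣p∣≡p∨∣p∣≡-p p
  ... | inj₁ eq = ≤-reflexive (sym eq)
  ... | inj₂ eq = ≤-trans
    (subst (_≤ 0ℚ) (neg-neg p) (neg-antimono-≤ (subst (0ℚ ≤_) eq (0≤∣p∣ p)))) (0≤∣p∣ p)
    where
    neg-neg : ∀ p → - (- p) ≡ p
    neg-neg = RingSolver.solve-∀ ring

  p≤q⇒0≤q-p : ∀ {p q} → p ≤ q → 0ℚ ≤ q - p
  p≤q⇒0≤q-p {p} {q} p≤q = subst (_≤ q - p) (+-inverseʳ p) (+-monoˡ-≤ (- p) p≤q)

  ∣z∣≤c⇒0≤c+z : ∀ {c z} → ∣ z ∣ ≤ c → 0ℚ ≤ c + z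
  ∣z∣≤c⇒0≤c+z {c} {z} le = subst (0ℚ ≤_) (eq c z)
    (p≤q⇒0≤q-p (≤-trans (p≤∣p∣ (- z)) (subst (_≤ c) (sym (∣-p∣≡∣p∣ z)) le)))
    where
    eq : ∀ c z → c - - z ≡ c + z
    eq = RingSolver.solve-∀ ring

  divide : ∀ {e m} → 0ℚ ≤ e → 0ℚ < m → ∃[ τ ] (0ℚ ≤ τ × τ * m ≡ e)
  divide {e} {m} 0≤e 0<m = e * inv , 0≤* 0≤e (<⇒≤ 0<inv) , (begin
      e * inv * m    ≡⟨ *-assoc e inv m ⟩
      e * (inv * m)  ≡⟨ cong (λ z → e * z) (*-inverseˡ m) ⟩
      e * 1ℚ         ≡⟨ *-identityʳ e ⟩
      e              ∎)
    where
    open ≡-Reasoning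
    instance
      m-pos : Positive m
      m-pos = positive 0<m
      m-nonZero : ℚ.NonZero m
      m-nonZero = pos⇒nonZero m
    inv : ℚ
    inv = 1/ m
    0<inv : 0ℚ < inv
    0<inv = positive⁻¹ inv {{1/pos⇒pos m}}

  divide⁺ : ∀ {e m} → 0ℚ < e → 0ℚ < m → ∃[ τ ] (0ℚ < τ × τ * m ≡ e)
  divide⁺ {e} {m} 0<e 0<m =
    let τ , _ , eq = divide (<⇒≤ 0<e) 0<m
    in τ , 0<*-cancelˡ (<⇒≤ 0<m) (subst (0ℚ <_) (trans (sym eq) (*-comm τ m)) 0<e) , eq

  private
    -- The summand 1 makes this a positive divisor even for a = b = 0, and strictly larger than ∣ a
    -- ∣ + ∣ b ∣.
    norm : ℚ → ℚ → ℚ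
    norm a b = 1ℚ + (∣ a ∣ + ∣ b ∣)

    0≤∣∣+∣∣ : ∀ a b → 0ℚ ≤ ∣ a ∣ + ∣ b ∣
    0≤∣∣+∣∣ a b = +-mono-≤ (0≤∣p∣ a) (0≤∣p∣ b)

    ∣∣+∣∣<norm : ∀ a b → ∣ a ∣ + ∣ b ∣ < norm a b
    ∣∣+∣∣<norm a b = subst (_< norm a b) (+-identityˡ (∣ a ∣ + ∣ b ∣))
      (+-monoˡ-< (∣ a ∣ + ∣ b ∣) (positive⁻¹ 1ℚ))

    0<norm : ∀ a b → 0ℚ < norm a b
    0<norm a b = ≤-<-trans (0≤∣∣+∣∣ a b) (∣∣+∣∣<norm a b)

  small-multiple : ∀ {ε} → 0ℚ < ε → ∀ a b → ∃[ τ ] (0ℚ < τ × ∣ τ * a ∣ < ε × ∣ τ * b ∣ < ε)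
  small-multiple {ε} 0<ε a b =
    τ , 0<τ , bound a (≤-<-trans le₁ (∣∣+∣∣<norm a b)) , bound b (≤-<-trans le₂ (∣∣+∣∣<norm a b))
    where
    quotient = divide⁺ 0<ε (0<norm a b)
    τ = proj₁ quotient
    0<τ : 0ℚ < τ
    0<τ = proj₁ (proj₂ quotient)
    τm≡ε : τ * norm a b ≡ ε
    τm≡ε = proj₂ (proj₂ quotient)
    bound : ∀ z → ∣ z ∣ < norm a b → ∣ τ * z ∣ < ε
    bound z lt = subst₂ _<_
      (sym (trans (∣p*q∣≡∣p∣*∣q∣ τ z) (cong (_* ∣ z ∣) (0≤p⇒∣p∣≡p (<⇒≤ 0<τ))))) τm≡ε
      (*-monoʳ-<-pos τ {{positive 0<τ}} lt)
    le₁ : ∣ a ∣ ≤ ∣ a ∣ + ∣ b ∣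
    le₁ = subst (_≤ ∣ a ∣ + ∣ b ∣) (+-identityʳ ∣ a ∣) (+-monoʳ-≤ ∣ a ∣ (0≤∣p∣ b))
    le₂ : ∣ b ∣ ≤ ∣ a ∣ + ∣ b ∣
    le₂ = subst (_≤ ∣ a ∣ + ∣ b ∣) (+-identityˡ ∣ b ∣) (+-monoˡ-≤ ∣ b ∣ (0≤∣p∣ a))

  -- For ε = c / `norm a b` the perturbation is at most ε (∣ a ∣ + ∣ b ∣) ≤ c. This is openness of a
  -- half-plane, with a weak conclusion because the nearby points are to lie in a closed hull.
  linear-stays-nonNeg : ∀ {c} → 0ℚ < c → ∀ a b →
    ∃[ ε ] (0ℚ < ε × (∀ x y → ∣ x ∣ < ε → ∣ y ∣ < ε → 0ℚ ≤ c + (a * y - b * x)))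
  linear-stays-nonNeg {c} 0<c a b = ε , 0<ε , λ x y ∣x∣<ε ∣y∣<ε → ∣z∣≤c⇒0≤c+z
    (≤-trans (∣p-q∣≤∣p∣+∣q∣ (a * y) (b * x))
      (≤-trans (+-mono-≤ (bound a y ∣y∣<ε) (bound b x ∣x∣<ε))
        (≤-trans (≤-reflexive (sym (*-distribˡ-+ ε ∣ a ∣ ∣ b ∣)))
          (subst (ε * (∣ a ∣ + ∣ b ∣) ≤_) εm≡c
            (*-monoˡ-≤-nonNeg ε {{nonNegative (<⇒≤ 0<ε)}} (<⇒≤ (∣∣+∣∣<norm a b)))))))
    where
    quotient = divide⁺ 0<c (0<norm a b)
    ε = proj₁ quotient
    0<ε : 0ℚ < ε
    0<ε = proj₁ (proj₂ quotient)
    εm≡c : ε * norm a b ≡ c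
    εm≡c = proj₂ (proj₂ quotient)
    bound : ∀ a y → ∣ y ∣ < ε → ∣ a * y ∣ ≤ ε * ∣ a ∣
    bound a y lt = subst₂ _≤_ (sym (∣p*q∣≡∣p∣*∣q∣ a y)) (*-comm ∣ a ∣ ε)
      (*-monoˡ-≤-nonNeg ∣ a ∣ {{∣-∣-nonNeg a}} (<⇒≤ lt))

  -- Hulls, interiors and signs of determinants

  -- As a function of P, `detℚ A B P` is affine and vanishes at A and B, so on the hull it is u
  -- times `detℚ A B C`. Multiplying a₁ and a₂ by s + t + u makes this a polynomial identity.
  hull-det : ∀ {A B C P} → 0ℚ ≤ detℚ A B C → Hull₃ A B C P → 0ℚ ≤ detℚ A B P
  hull-det {a₁ , a₂} {b₁ , b₂} {c₁ , c₂} 0≤D (s , t , u , _ , _ , 0≤u , s+t+u≡1 , refl) =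
    subst (0ℚ ≤_) (sym eq) (0≤* 0≤u 0≤D)
    where
    identity : ∀ a₁ a₂ b₁ b₂ c₁ c₂ s t u →
      (b₁ - a₁) * ((s * a₂ + t * b₂ + u * c₂) - (s + t + u) * a₂) -
      (b₂ - a₂) * ((s * a₁ + t * b₁ + u * c₁) - (s + t + u) * a₁) ≡
      u * ((b₁ - a₁) * (c₂ - a₂) - (b₂ - a₂) * (c₁ - a₁))
    identity = RingSolver.solve-∀ ring
    1* : ∀ z → (s + t + u) * z ≡ z
    1* z = trans (cong (_* z) s+t+u≡1) (*-identityˡ z)
    eq = trans
      (cong₂ (λ y x → (b₁ - a₁) * ((s * a₂ + t * b₂ + u * c₂) - y) - (b₂ - a₂) * ((s * a₁ + t * b₁ + u * c₁) - x))
        (sym (1* a₂)) (sym (1* a₁)))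
      (identity a₁ a₂ b₁ b₂ c₁ c₂ s t u)

  -- Moving from P away from C would leave the hull if P were on the line AB or beyond it.
  interior-det : ∀ {A B C P} → 0ℚ < detℚ A B C → Interior (Hull₃ A B C) P → 0ℚ < detℚ A B P
  interior-det {a₁ , a₂} {b₁ , b₂} {c₁ , c₂} {x , y} 0<D (ε , 0<ε , ball) =
    0<*-cancelˡ (<⇒≤ 0<1+τ) (<-≤-trans (0<* 0<τ 0<D) τD≤)
    where
    step = small-multiple 0<ε (x - c₁) (y - c₂)
    τ = proj₁ step
    0<τ : 0ℚ < τ
    0<τ = proj₁ (proj₂ step)
    x-small : ∣ τ * (x - c₁) ∣ < ε
    x-small = proj₁ (proj₂ (proj₂ step))
    y-small : ∣ τ * (y - c₂) ∣ < ε
    y-small = proj₂ (proj₂ (proj₂ step))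
    D = (b₁ - a₁) * (c₂ - a₂) - (b₂ - a₂) * (c₁ - a₁)
    d = (b₁ - a₁) * (y - a₂) - (b₂ - a₂) * (x - a₁)
    0<1+τ : 0ℚ < 1ℚ + τ
    0<1+τ = +-mono-< (positive⁻¹ 1ℚ) 0<τ
    moved : ∀ x z → x + z - x ≡ z
    moved = RingSolver.solve-∀ ring
    0≤d′ = hull-det (<⇒≤ 0<D) (ball (x + τ * (x - c₁)) (y + τ * (y - c₂))
      (subst (λ z → ∣ z ∣ < ε) (sym (moved x (τ * (x - c₁)))) x-small)
      (subst (λ z → ∣ z ∣ < ε) (sym (moved y (τ * (y - c₂)))) y-small))
    identity : ∀ a₁ a₂ b₁ b₂ c₁ c₂ x y τ →
      (b₁ - a₁) * (y + τ * (y - c₂) - a₂) - (b₂ - a₂) * (x + τ * (x - c₁) - a₁) +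
        τ * ((b₁ - a₁) * (c₂ - a₂) - (b₂ - a₂) * (c₁ - a₁)) ≡
      (1ℚ + τ) * ((b₁ - a₁) * (y - a₂) - (b₂ - a₂) * (x - a₁))
    identity = RingSolver.solve-∀ ring
    -- P is the mean of the moved point and C with weights 1 and τ, so (1 + τ) d is the nonnegative
    -- determinant at the moved point plus τ D.
    τD≤ : τ * D ≤ (1ℚ + τ) * d
    τD≤ = subst₂ _≤_ (+-identityˡ (τ * D)) (identity a₁ a₂ b₁ b₂ c₁ c₂ x y τ)
      (+-monoˡ-≤ (τ * D) 0≤d′)

  det-stays-nonNeg : ∀ A B x y → 0ℚ < detℚ A B (x , y) →
    ∃[ ε ] (0ℚ < ε × (∀ x′ y′ → ∣ x′ - x ∣ < ε → ∣ y′ - y ∣ < ε → 0ℚ ≤ detℚ A B (x′ , y′)))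
  det-stays-nonNeg (a₁ , a₂) (b₁ , b₂) x y 0<d =
    let ε , 0<ε , near = linear-stays-nonNeg 0<d (b₁ - a₁) (b₂ - a₂)
    in ε , 0<ε , λ x′ y′ lt₁ lt₂ →
    subst (0ℚ ≤_) (identity a₁ a₂ b₁ b₂ x y x′ y′) (near (x′ - x) (y′ - y) lt₁ lt₂)
    where
    identity : ∀ a₁ a₂ b₁ b₂ x y x′ y′ →
      ((b₁ - a₁) * (y - a₂) - (b₂ - a₂) * (x - a₁)) + ((b₁ - a₁) * (y′ - y) - (b₂ - a₂) * (x′ - x)) ≡
      (b₁ - a₁) * (y′ - a₂) - (b₂ - a₂) * (x′ - a₁)
    identity = RingSolver.solve-∀ ring

  -- Barycentric coordinates by Cramer's rule: the weight of a vertex is the determinant of P with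
  -- the opposite side, divided by D. The equations are verified after multiplication by D.
  dets-hull : ∀ {A B C P} → 0ℚ < detℚ A B C →
    0ℚ ≤ detℚ A B P → 0ℚ ≤ detℚ B C P → 0ℚ ≤ detℚ C A P → Hull₃ A B C P
  dets-hull {A@(a₁ , a₂)} {B@(b₁ , b₂)} {C@(c₁ , c₂)} {P@(x , y)} 0<D 0≤d₁ 0≤d₂ 0≤d₃ =
    s , t , u , proj₁ (proj₂ qs) , proj₁ (proj₂ qt) , proj₁ (proj₂ qu) , sum≡1 , cong₂ _,_ (coordinate x a₁ b₁ c₁ (identity₁ a₁ a₂ b₁ b₂ c₁ c₂ x y)) (coordinate y a₂ b₂ c₂ (identity₂ a₁ a₂ b₁ b₂ c₁ c₂ x y))
    where
    D = detℚ A B C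
    qs = divide 0≤d₂ 0<D
    qt = divide 0≤d₃ 0<D
    qu = divide 0≤d₁ 0<D
    s = proj₁ qs
    t = proj₁ qt
    u = proj₁ qu
    sD : s * D ≡ detℚ B C P
    sD = proj₂ (proj₂ qs)
    tD : t * D ≡ detℚ C A P
    tD = proj₂ (proj₂ qt)
    uD : u * D ≡ detℚ A B P
    uD = proj₂ (proj₂ qu)
    cancel : ∀ {p q} → p * D ≡ q * D → p ≡ q
    cancel {p} {q} eq = ≤-antisym
      (*-cancelʳ-≤-pos D {{positive 0<D}} (≤-reflexive eq))
      (*-cancelʳ-≤-pos D {{positive 0<D}} (≤-reflexive (sym eq)))
    identity₀ : ∀ a₁ a₂ b₁ b₂ c₁ c₂ x y →
      ((c₁ - b₁) * (y - b₂) - (c₂ - b₂) * (x - b₁)) +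
      ((a₁ - c₁) * (y - c₂) - (a₂ - c₂) * (x - c₁)) +
      ((b₁ - a₁) * (y - a₂) - (b₂ - a₂) * (x - a₁)) ≡
      (b₁ - a₁) * (c₂ - a₂) - (b₂ - a₂) * (c₁ - a₁)
    identity₀ = RingSolver.solve-∀ ring
    identity₁ : ∀ a₁ a₂ b₁ b₂ c₁ c₂ x y →
      ((c₁ - b₁) * (y - b₂) - (c₂ - b₂) * (x - b₁)) * a₁ +
      ((a₁ - c₁) * (y - c₂) - (a₂ - c₂) * (x - c₁)) * b₁ +
      ((b₁ - a₁) * (y - a₂) - (b₂ - a₂) * (x - a₁)) * c₁ ≡
      x * ((b₁ - a₁) * (c₂ - a₂) - (b₂ - a₂) * (c₁ - a₁))
    identity₁ = RingSolver.solve-∀ ring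
    identity₂ : ∀ a₁ a₂ b₁ b₂ c₁ c₂ x y →
      ((c₁ - b₁) * (y - b₂) - (c₂ - b₂) * (x - b₁)) * a₂ +
      ((a₁ - c₁) * (y - c₂) - (a₂ - c₂) * (x - c₁)) * b₂ +
      ((b₁ - a₁) * (y - a₂) - (b₂ - a₂) * (x - a₁)) * c₂ ≡
      y * ((b₁ - a₁) * (c₂ - a₂) - (b₂ - a₂) * (c₁ - a₁))
    identity₂ = RingSolver.solve-∀ ring
    expand : ∀ s t u D → (s + t + u) * D ≡ s * D + t * D + u * D
    expand = RingSolver.solve-∀ ring
    expand′ : ∀ s t u a b c D → (s * a + t * b + u * c) * D ≡ (s * D) * a + (t * D) * b + (u * D) * c
    expand′ = RingSolver.solve-∀ ring
    sum≡1 : s + t + u ≡ 1ℚ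
    sum≡1 = cancel (trans (expand s t u D)
      (trans (cong₂ _+_ (cong₂ _+_ sD tD) uD)
        (trans (identity₀ a₁ a₂ b₁ b₂ c₁ c₂ x y) (sym (*-identityˡ D)))))
    coordinate : ∀ z a b c →
      detℚ B C P * a + detℚ C A P * b + detℚ A B P * c ≡ z * D → z ≡ s * a + t * b + u * c
    coordinate z a b c eq = sym (cancel (trans (expand′ s t u a b c D)
      (trans (cong₂ _+_ (cong₂ _+_ (cong (_* a) sD) (cong (_* b) tD)) (cong (_* c) uD)) eq)))

  hull-rotate : ∀ {A B C P} → Hull₃ A B C P → Hull₃ B C A P
  hull-rotate {a₁ , a₂} {b₁ , b₂} {c₁ , c₂} (s , t , u , 0≤s , 0≤t , 0≤u , eq , refl) =
    t , u , s , 0≤t , 0≤u , 0≤s , trans (sym (rotate s t u)) eq ,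
    cong₂ _,_ (rotate (s * a₁) (t * b₁) (u * c₁)) (rotate (s * a₂) (t * b₂) (u * c₂))
    where
    rotate : ∀ p q r → p + q + r ≡ q + r + p
    rotate = RingSolver.solve-∀ ring

  hull-swap : ∀ {A B C P} → Hull₃ A B C P → Hull₃ B A C P
  hull-swap {a₁ , a₂} {b₁ , b₂} {c₁ , c₂} (s , t , u , 0≤s , 0≤t , 0≤u , eq , refl) =
    t , s , u , 0≤t , 0≤s , 0≤u , trans (cong (_+ u) (+-comm t s)) eq ,
    cong₂ _,_ (cong (_+ u * c₁) (+-comm (s * a₁) (t * b₁))) (cong (_+ u * c₂) (+-comm (s * a₂) (t * b₂)))

  segment-swap : ∀ {A B P} → Segment A B P → Segment B A P
  segment-swap {a₁ , a₂} {b₁ , b₂} (s , t , 0≤s , 0≤t , eq , refl) =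
    t , s , 0≤t , 0≤s , trans (+-comm t s) eq ,
    cong₂ _,_ (+-comm (s * a₁) (t * b₁)) (+-comm (s * a₂) (t * b₂))

  interior-mono : ∀ {S T : Plane → Set} → (∀ {P} → S P → T P) → ∀ {P} → Interior S P → Interior T P
  interior-mono S⊆T {x , y} (ε , 0<ε , ball) = ε , 0<ε , λ x′ y′ lt₁ lt₂ → S⊆T (ball x′ y′ lt₁ lt₂)

  -- Each strict inequality survives weakly on some box around P; the smallest of the three radii
  -- serves for all.
  dets-interior : ∀ {A B C P} → 0ℚ < detℚ A B C →
    0ℚ < detℚ A B P → 0ℚ < detℚ B C P → 0ℚ < detℚ C A P → Interior (Hull₃ A B C) P
  dets-interior {A} {B} {C} {x , y} 0<D 0<d₁ 0<d₂ 0<d₃ = combine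
      (det-stays-nonNeg A B x y 0<d₁) (det-stays-nonNeg B C x y 0<d₂) (det-stays-nonNeg C A x y 0<d₃)
    where
    Near : Plane → Plane → Set
    Near A B = ∃[ ε ] (0ℚ < ε ×
      (∀ x′ y′ → ∣ x′ - x ∣ < ε → ∣ y′ - y ∣ < ε → 0ℚ ≤ detℚ A B (x′ , y′)))
    ⊓-pos : ∀ {p q} → 0ℚ < p → 0ℚ < q → 0ℚ < p ⊓ q
    ⊓-pos {p} {q} 0<p 0<q with ⊓-sel p q
    ... | inj₁ eq = subst (0ℚ <_) (sym eq) 0<p
    ... | inj₂ eq = subst (0ℚ <_) (sym eq) 0<q
    combine : Near A B → Near B C → Near C A → Interior (Hull₃ A B C) (x , y)
    combine (ε₁ , 0<ε₁ , near₁) (ε₂ , 0<ε₂ , near₂) (ε₃ , 0<ε₃ , near₃) =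
      ε , ⊓-pos (⊓-pos 0<ε₁ 0<ε₂) 0<ε₃ , λ x′ y′ lt₁ lt₂ → dets-hull 0<D
        (near₁ x′ y′ (<-≤-trans lt₁ ε≤ε₁) (<-≤-trans lt₂ ε≤ε₁))
        (near₂ x′ y′ (<-≤-trans lt₁ ε≤ε₂) (<-≤-trans lt₂ ε≤ε₂))
        (near₃ x′ y′ (<-≤-trans lt₁ ε≤ε₃) (<-≤-trans lt₂ ε≤ε₃))
      where
      ε = (ε₁ ⊓ ε₂) ⊓ ε₃
      ε≤ε₁ : ε ≤ ε₁
      ε≤ε₁ = ≤-trans (p⊓q≤p (ε₁ ⊓ ε₂) ε₃) (p⊓q≤p ε₁ ε₂)
      ε≤ε₂ : ε ≤ ε₂
      ε≤ε₂ = ≤-trans (p⊓q≤p (ε₁ ⊓ ε₂) ε₃) (p⊓q≤q ε₁ ε₂)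
      ε≤ε₃ : ε ≤ ε₃
      ε≤ε₃ = p⊓q≤q (ε₁ ⊓ ε₂) ε₃

  det-pos : ∀ {A B C} → 0ℤ ℤ.< det A B C → 0ℚ < detℚ (ι A) (ι B) (ι C)
  det-pos {A} {B} {C} lt = subst (0ℚ <_) (det-ι A B C) (/1-mono-< lt)

  detℚ-pos : ∀ {A B C} → 0ℚ < detℚ (ι A) (ι B) (ι C) → 0ℤ ℤ.< det A B C
  detℚ-pos {A} {B} {C} lt = /1-cancel-< (subst (0ℚ <_) (sym (det-ι A B C)) lt)

  det-rotate : ∀ A B C → det A B C ≡ det B C A
  det-rotate (a₁ , a₂) (b₁ , b₂) (c₁ , c₂) = identity a₁ a₂ b₁ b₂ c₁ c₂
    where
    identity : ∀ a₁ a₂ b₁ b₂ c₁ c₂ →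
      (b₁ ℤ.- a₁) ℤ.* (c₂ ℤ.- a₂) ℤ.- (b₂ ℤ.- a₂) ℤ.* (c₁ ℤ.- a₁) ≡
      (c₁ ℤ.- b₁) ℤ.* (a₂ ℤ.- b₂) ℤ.- (c₂ ℤ.- b₂) ℤ.* (a₁ ℤ.- b₁)
    identity = ℤ-Ring.solve-∀

  -- Necessity was proved for the side AB alone; rotating the triangle yields the other two sides.
  interior⇔dets : ∀ {A B C} → 0ℤ ℤ.< det A B C → ∀ P →
    Interior (Hull₃ (ι A) (ι B) (ι C)) (ι P) ⇔
    (0ℤ ℤ.< det A B P × 0ℤ ℤ.< det B C P × 0ℤ ℤ.< det C A P)
  interior⇔dets {A} {B} {C} 0<D P = mk⇔
    (λ int →
      let int′ = interior-mono hull-rotate int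
          int″ = interior-mono hull-rotate int′
      in detℚ-pos {A} {B} {P} (interior-det (det-pos {A} {B} {C} 0<D) int)
       , detℚ-pos {B} {C} {P} (interior-det (det-pos {B} {C} {A} 0<D′) int′)
       , detℚ-pos {C} {A} {P} (interior-det (det-pos {C} {A} {B} 0<D″) int″))
    (λ (0<d₁ , 0<d₂ , 0<d₃) → dets-interior (det-pos {A} {B} {C} 0<D)
      (det-pos {A} {B} {P} 0<d₁) (det-pos {B} {C} {P} 0<d₂) (det-pos {C} {A} {P} 0<d₃))
    where
    0<D′ = subst (0ℤ ℤ.<_) (det-rotate A B C) 0<D
    0<D″ = subst (0ℤ ℤ.<_) (det-rotate B C A) 0<D′

  -- The parameter of a lattice point on a primitive direction is an integer, being dual ∙ (P − A).
  segment⇒onEdge : ∀ {A B g} (e : Edge A B g) {P} → Segment (ι A) (ι B) (ι P) → OnEdge e P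
  segment⇒onEdge {A@(a₁ , a₂)} {B} {g} (edge (v₁ , v₂) (u₁ , u₂) bez refl) {x , y}
    (s , t , 0≤s , 0≤t , s+t≡1 , P≡) =
    n , /1-cancel-≤ {0ℤ} {n} (subst (0ℚ ≤_) (sym n≡) 0≤tg) ,
    /1-cancel-≤ {n} {+ g} (subst₂ _≤_ (sym n≡) (*-identityˡ (+ g / 1)) (*-monoʳ-≤-nonNeg (+ g / 1) {{nonNegative 0≤g}} t≤1)) ,
    cong₂ _,_ (/1-injective (coordinate x a₁ v₁ x≡)) (/1-injective (coordinate y a₂ v₂ y≡))
    where
    n : ℤ
    n = u₁ ℤ.* (x ℤ.- a₁) ℤ.+ u₂ ℤ.* (y ℤ.- a₂)
    0≤g : 0ℚ ≤ + g / 1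
    0≤g = /1-mono-≤ {0ℤ} {+ g} (ℤ.+≤+ ℕ.z≤n)
    0≤tg : 0ℚ ≤ t * (+ g / 1)
    0≤tg = 0≤* 0≤t 0≤g
    t≤1 : t ≤ 1ℚ
    t≤1 = subst₂ _≤_ (+-identityˡ t) s+t≡1 (+-monoˡ-≤ t 0≤s)
    identity : ∀ s t a g v → s * a + t * (a + g * v) ≡ (s + t) * a + t * g * v
    identity = RingSolver.solve-∀ ring
    point : ∀ a v → s * (a / 1) + t * ((a ℤ.+ + g ℤ.* v) / 1) ≡ a / 1 + t * (+ g / 1) * (v / 1)
    point a v = trans
      (cong (λ z → s * (a / 1) + t * z)
        (trans (/1-homo-+ a (+ g ℤ.* v)) (cong (λ z → a / 1 + z) (/1-homo-* (+ g) v))))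
      (trans (identity s t (a / 1) (+ g / 1) (v / 1))
        (cong (λ z → z + t * (+ g / 1) * (v / 1)) (trans (cong (_* (a / 1)) s+t≡1) (*-identityˡ (a / 1)))))
    x≡ : x / 1 ≡ a₁ / 1 + t * (+ g / 1) * (v₁ / 1)
    x≡ = trans (cong proj₁ P≡) (point a₁ v₁)
    y≡ : y / 1 ≡ a₂ / 1 + t * (+ g / 1) * (v₂ / 1)
    y≡ = trans (cong proj₂ P≡) (point a₂ v₂)
    cancel : ∀ a z → a + z - a ≡ z
    cancel = RingSolver.solve-∀ ring
    difference : ∀ x a v → x / 1 ≡ a / 1 + t * (+ g / 1) * (v / 1) →
      (x ℤ.- a) / 1 ≡ t * (+ g / 1) * (v / 1)
    difference x a v eq = trans (/1-homo-- x a)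
      (trans (cong (λ z → z - a / 1) eq) (cancel (a / 1) (t * (+ g / 1) * (v / 1))))
    collect : ∀ u₁ u₂ v₁ v₂ τ → u₁ * (τ * v₁) + u₂ * (τ * v₂) ≡ τ * (u₁ * v₁ + u₂ * v₂)
    collect = RingSolver.solve-∀ ring
    bezℚ : u₁ / 1 * (v₁ / 1) + u₂ / 1 * (v₂ / 1) ≡ 1ℚ
    bezℚ = trans (sym (trans (/1-homo-+ (u₁ ℤ.* v₁) (u₂ ℤ.* v₂)) (cong₂ _+_ (/1-homo-* u₁ v₁) (/1-homo-* u₂ v₂))))
      (cong (_/ 1) bez)
    n≡ : n / 1 ≡ t * (+ g / 1)
    n≡ = trans (/1-homo-+ (u₁ ℤ.* (x ℤ.- a₁)) (u₂ ℤ.* (y ℤ.- a₂)))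
      (trans (cong₂ _+_
        (trans (/1-homo-* u₁ (x ℤ.- a₁)) (cong (u₁ / 1 *_) (difference x a₁ v₁ x≡)))
        (trans (/1-homo-* u₂ (y ℤ.- a₂)) (cong (u₂ / 1 *_) (difference y a₂ v₂ y≡))))
      (trans (collect (u₁ / 1) (u₂ / 1) (v₁ / 1) (v₂ / 1) (t * (+ g / 1)))
      (trans (cong (λ z → t * (+ g / 1) * z) bezℚ) (*-identityʳ (t * (+ g / 1))))))
    coordinate : ∀ x a v → x / 1 ≡ a / 1 + t * (+ g / 1) * (v / 1) → x / 1 ≡ (a ℤ.+ n ℤ.* v) / 1
    coordinate x a v eq = trans eq (sym (trans (/1-homo-+ a (n ℤ.* v))
      (cong (λ z → a / 1 + z) (trans (/1-homo-* n v) (cong (_* (v / 1)) n≡)))))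

  onEdge⇒segment : ∀ {A B g} (e : Edge A B (suc g)) {P} → OnEdge e P → Segment (ι A) (ι B) (ι P)
  onEdge⇒segment {a₁ , a₂} {B} {g} (edge (v₁ , v₂) _ _ refl) (n , 0≤n , n≤g , refl) =
    1ℚ - t , t , p≤q⇒0≤q-p t≤1 , proj₁ (proj₂ quotient) , one t , cong₂ _,_ (coordinate a₁ v₁) (coordinate a₂ v₂)
    where
    0<g : 0ℚ < + suc g / 1
    0<g = /1-mono-< {0ℤ} {+ suc g} (ℤ.+<+ ℕ.z<s)
    quotient = divide {n / 1} {+ suc g / 1} (/1-mono-≤ {0ℤ} {n} 0≤n) 0<g
    t = proj₁ quotient
    tg≡n : t * (+ suc g / 1) ≡ n / 1
    tg≡n = proj₂ (proj₂ quotient)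
    t≤1 : t ≤ 1ℚ
    t≤1 = *-cancelʳ-≤-pos (+ suc g / 1) {{positive 0<g}}
      (subst₂ _≤_ (sym tg≡n) (sym (*-identityˡ (+ suc g / 1))) (/1-mono-≤ {n} {+ suc g} n≤g))
    one : ∀ t → 1ℚ - t + t ≡ 1ℚ
    one = RingSolver.solve-∀ ring
    identity : ∀ t a g v → a + t * g * v ≡ (1ℚ - t) * a + t * (a + g * v)
    identity = RingSolver.solve-∀ ring
    coordinate : ∀ a v → (a ℤ.+ n ℤ.* v) / 1 ≡ (1ℚ - t) * (a / 1) + t * ((a ℤ.+ + suc g ℤ.* v) / 1)
    coordinate a v = trans (/1-homo-+ a (n ℤ.* v))
      (trans (cong (λ z → a / 1 + z) (trans (/1-homo-* n v) (cong (_* (v / 1)) (sym tg≡n))))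
      (trans (identity t (a / 1) (+ suc g / 1) (v / 1))
        (cong (λ z → (1ℚ - t) * (a / 1) + t * z)
          (sym (trans (/1-homo-+ a (+ suc g ℤ.* v)) (cong (λ z → a / 1 + z) (/1-homo-* (+ suc g) v)))))))

  -- Lines and non-collinearity

  integral-line : ∀ a b c → ¬ (a ≡ 0ℤ × b ≡ 0ℤ) →
    Σ[ ℓ ∈ Line ] (∀ P → (a , b) ∙ P ≡ c → OnLine ℓ (ι P))
  integral-line a b c ab≢0 =
    record { a = a / 1; b = b / 1; c = c / 1
           ; nontrivial = λ (a≡0 , b≡0) → ab≢0 (/1-injective a≡0 , /1-injective b≡0) } ,
    λ (x , y) eq → trans
      (sym (trans (/1-homo-+ (a ℤ.* x) (b ℤ.* y)) (cong₂ _+_ (/1-homo-* a x) (/1-homo-* b y))))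
      (cong (_/ 1) eq)

  -- Subtracting the line's equations at the vertices leaves a homogeneous linear system for its
  -- normal (a , b) with determinant D; Cramer's rule gives a D = b D = 0.
  det≢0⇒non-collinear : ∀ {A B C} → det A B C ≢ 0ℤ →
    ¬ (Σ[ ℓ ∈ Line ] (OnLine ℓ (ι A) × OnLine ℓ (ι B) × OnLine ℓ (ι C)))
  det≢0⇒non-collinear {A@(a₁ , a₂)} {B@(b₁ , b₂)} {C@(c₁ , c₂)} D≢0 (ℓ , onA , onB , onC) =
    Line.nontrivial ℓ
      ( cancel a (c₂ / 1 - a₂ / 1) (b₂ / 1 - a₂ / 1) (identity₁ a b (a₁ / 1) (a₂ / 1) (b₁ / 1) (b₂ / 1) (c₁ / 1) (c₂ / 1))
      , cancel b (a₁ / 1 - c₁ / 1) (a₁ / 1 - b₁ / 1) (identity₂ a b (a₁ / 1) (a₂ / 1) (b₁ / 1) (b₂ / 1) (c₁ / 1) (c₂ / 1)))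
    where
    open Line ℓ
    D = detℚ (ι A) (ι B) (ι C)
    D-nonZero : ℚ.NonZero D
    D-nonZero = ≢-nonZero λ D≡0 → D≢0 (/1-injective (trans (det-ι A B C) D≡0))
    identity₁ : ∀ a b a₁ a₂ b₁ b₂ c₁ c₂ →
      a * ((b₁ - a₁) * (c₂ - a₂) - (b₂ - a₂) * (c₁ - a₁)) ≡
      (c₂ - a₂) * ((a * b₁ + b * b₂) - (a * a₁ + b * a₂)) -
      (b₂ - a₂) * ((a * c₁ + b * c₂) - (a * a₁ + b * a₂))
    identity₁ = RingSolver.solve-∀ ring
    identity₂ : ∀ a b a₁ a₂ b₁ b₂ c₁ c₂ →
      b * ((b₁ - a₁) * (c₂ - a₂) - (b₂ - a₂) * (c₁ - a₁)) ≡
      (a₁ - c₁) * ((a * b₁ + b * b₂) - (a * a₁ + b * a₂)) -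
      (a₁ - b₁) * ((a * c₁ + b * c₂) - (a * a₁ + b * a₂))
    identity₂ = RingSolver.solve-∀ ring
    vanish : ∀ p q c → p * (c - c) - q * (c - c) ≡ 0ℚ
    vanish = RingSolver.solve-∀ ring
    cancel : ∀ z p q → z * D ≡
      p * ((a * (b₁ / 1) + b * (b₂ / 1)) - (a * (a₁ / 1) + b * (a₂ / 1))) -
      q * ((a * (c₁ / 1) + b * (c₂ / 1)) - (a * (a₁ / 1) + b * (a₂ / 1))) → z ≡ 0ℚ
    cancel z p q eq = begin
      z                  ≡⟨ *-identityʳ z ⟨
      z * 1ℚ             ≡⟨ cong (z *_) (*-inverseʳ D {{D-nonZero}}) ⟨
      z * (D * inv)      ≡⟨ *-assoc z D inv ⟨
      z * D * inv        ≡⟨ cong (_* inv) (trans eq (trans (cong₂ (λ β γ → p * β - q * γ) (cong₂ _-_ onB onA) (cong₂ _-_ onC onA)) (vanish p q c))) ⟩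
      0ℚ * inv           ≡⟨ *-zeroˡ inv ⟩
      0ℚ                 ∎
      where
      open ≡-Reasoning
      inv = (1/ D) {{D-nonZero}}

open RationalGeometry
  using (det-rotate; interior⇔dets; segment⇒onEdge; onEdge⇒segment; segment-swap
        ; hull-rotate; hull-swap; interior-mono; integral-line; det≢0⇒non-collinear)
open import Data.Integer.Base using (_+_; _-_; _*_; -_; _≤_; _<_; ∣_∣)

-- Counting lattice points

enumerate : ∀ {n} {S : Pred Lattice 0ℓ} (f : Fin n → Lattice) → (∀ {i j} → f i ≡ f j → i ≡ j) →
  (∀ i → S (f i)) → (∀ P → S P → ∃[ i ] P ≡ f i) → HasExactly n S
enumerate {S = S} f f-injective sound complete =
  tabulate f , Unique.tabulate⁺ f-injective , List.length-tabulate f , λ P → mk⇔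
    (λ P∈ → case ∈-tabulate⁻ {f = f} P∈ of λ { (i , refl) → sound i })
    (λ SP → case complete P SP of λ { (i , refl) → ∈-tabulate⁺ {f = f} i })

-- Two duplicate-free lists with the same members are permutations of each other. This allows an
-- assumed count to be compared with a computed one.
hasExactly-unique : ∀ {m n S} → HasExactly m S → HasExactly n S → m ≡ n
hasExactly-unique (ps , ps! , |ps|≡m , ps⇔S) (qs , qs! , |qs|≡n , qs⇔S) =
  trans (sym |ps|≡m) (trans (↭-length (∼bag⇒↭ (unique∧set⇒bag ps! qs! λ {P} →
    mk⇔ (from (qs⇔S P) ∘ to (ps⇔S P)) (from (ps⇔S P) ∘ to (qs⇔S P))))) |qs|≡n)

hasExactly-resp : ∀ {n S T} → (∀ P → S P ⇔ T P) → HasExactly n S → HasExactly n T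
hasExactly-resp S⇔T (ps , ps! , |ps|≡n , ps⇔S) =
  ps , ps! , |ps|≡n , λ P → mk⇔ (to (S⇔T P) ∘ to (ps⇔S P)) (from (ps⇔S P) ∘ from (S⇔T P))

hasExactly-⊎ : ∀ {m n} {S T : Pred Lattice 0ℓ} → (∀ {P} → S P → T P → ⊥) →
  HasExactly m S → HasExactly n T → HasExactly (m ℕ.+ n) (λ P → S P ⊎ T P)
hasExactly-⊎ disjoint (ps , ps! , |ps|≡m , ps⇔S) (qs , qs! , |qs|≡n , qs⇔T) =
  ps ++ qs ,
  Unique.++⁺ ps! qs! (λ {P} (P∈ps , P∈qs) → disjoint (to (ps⇔S P) P∈ps) (to (qs⇔T P) P∈qs)) ,
  trans (List.length-++ ps) (cong₂ ℕ._+_ |ps|≡m |qs|≡n) ,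
  λ P → mk⇔
    (λ P∈ → case ∈-++⁻ ps P∈ of λ
      { (inj₁ P∈ps) → inj₁ (to (ps⇔S P) P∈ps)
      ; (inj₂ P∈qs) → inj₂ (to (qs⇔T P) P∈qs) })
    (λ { (inj₁ SP) → ∈-++⁺ˡ (from (ps⇔S P) SP)
       ; (inj₂ TP) → ∈-++⁺ʳ ps (from (qs⇔T P) TP) })

hasExactly-bijection : ∀ {n} {S : Pred Lattice 0ℓ} (f g : Lattice → Lattice) →
  (∀ P → f (g P) ≡ P) → (∀ P → g (f P) ≡ P) → HasExactly n S → HasExactly n (λ P → S (g P))
hasExactly-bijection {S = S} f g fg gf (ps , ps! , |ps|≡n , ps⇔S) =
  map f ps ,
  Unique.map⁺ (λ {P} {Q} eq → trans (sym (gf P)) (trans (cong g eq) (gf Q))) ps! ,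
  trans (List.length-map f ps) |ps|≡n ,
  λ P → mk⇔
    (λ P∈ → case ∈-map⁻ f P∈ of λ { (Q , Q∈ , refl) → subst S (sym (gf Q)) (to (ps⇔S Q) Q∈) })
    (λ SgP → subst (_∈ map f ps) (fg P) (∈-map⁺ f (from (ps⇔S (g P)) SgP)))

-- Integer inequalities

0<-resp : ∀ {a b} → a ≡ b → 0ℤ < a → 0ℤ < b
0<-resp eq = subst (0ℤ <_) eq

0<+ : ∀ {a b} → 0ℤ < a → 0ℤ < b → 0ℤ < a + b
0<+ = ℤ.+-mono-<

<⇒0<- : ∀ {a b} → a < b → 0ℤ < b - a
<⇒0<- {a} {b} a<b = subst (_< b - a) (ℤ.+-inverseʳ a) (ℤ.+-monoˡ-< (- a) a<b)

0<-⇒< : ∀ {a b} → 0ℤ < b - a → a < b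
0<-⇒< {a} {b} lt = subst₂ _<_ (ℤ.+-identityʳ a) (eq a b) (ℤ.+-monoʳ-< a lt)
  where
  eq : ∀ a b → a + (b - a) ≡ b
  eq = ℤ-Ring.solve-∀

0<*-cancelˡ : ∀ {h z} → 0ℤ < h → 0ℤ < h * z → 0ℤ < z
0<*-cancelˡ {h} {z} 0<h 0<hz =
  ℤ.*-cancelˡ-<-nonNeg h {{ℤ.nonNegative (ℤ.<⇒≤ 0<h)}} (subst (_< h * z) (sym (ℤ.*-zeroʳ h)) 0<hz)

0<z<1-absurd : ∀ {z} → 0ℤ < z → 0ℤ < 1ℤ - z → ⊥
0<z<1-absurd {z} 0<z 0<1-z with ℤ.i<j⇒suc[i]≤j 0<z
... | 1≤z = ℤ.<-irrefl refl (ℤ.<-≤-trans (0<-⇒< 0<1-z) 1≤z)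

0<hz<h-absurd : ∀ {h z} → 0ℤ < h → 0ℤ < h * z → 0ℤ < h - h * z → ⊥
0<hz<h-absurd {h} {z} 0<h 0<hz hz<h =
  0<z<1-absurd (0<*-cancelˡ 0<h 0<hz) (0<*-cancelˡ 0<h (0<-resp (factor h z) hz<h))
  where
  factor : ∀ h z → h - h * z ≡ h * (1ℤ - z)
  factor = ℤ-Ring.solve-∀

toFin : ∀ {z n} → 0ℤ ≤ z → z < + n → Σ[ i ∈ Fin n ] z ≡ + toℕ i
toFin {+ m} _ (ℤ.+<+ m<n) = fromℕ< m<n , cong +_ (sym (Fin.toℕ-fromℕ< m<n))

-- Half-open edges and the number of boundary points

diff : Lattice → Lattice → Lattice
diff (a₁ , a₂) (p₁ , p₂) = (p₁ - a₁) , (p₂ - a₂)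

dual-shift : ∀ A n v u → u ∙ v ≡ 1ℤ → u ∙ diff A (shift A n v) ≡ n
dual-shift (a₁ , a₂) n (v₁ , v₂) (u₁ , u₂) bez =
  trans (identity a₁ a₂ n v₁ v₂ u₁ u₂) (trans (cong (λ z → n * z) bez) (ℤ.*-identityʳ n))
  where
  identity : ∀ a₁ a₂ n v₁ v₂ u₁ u₂ →
    u₁ * (a₁ + n * v₁ - a₁) + u₂ * (a₂ + n * v₂ - a₂) ≡ n * (u₁ * v₁ + u₂ * v₂)
  identity = ℤ-Ring.solve-∀

shift-injective : ∀ A {m n} v u → u ∙ v ≡ 1ℤ → shift A m v ≡ shift A n v → m ≡ n
shift-injective A {m} {n} v u bez eq =
  trans (sym (dual-shift A m v u bez)) (trans (cong (λ P → u ∙ diff A P) eq) (dual-shift A n v u bez))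

shift-zero : ∀ A v → shift A 0ℤ v ≡ A
shift-zero (a₁ , a₂) (v₁ , v₂) = cong₂ _,_ (eq a₁ v₁) (eq a₂ v₂)
  where
  eq : ∀ a v → a + 0ℤ * v ≡ a
  eq = ℤ-Ring.solve-∀

-- Without its end an edge of g primitive steps has exactly g points, and the three half-open edges,
-- taken cyclically, partition the boundary.
HalfOpen : ∀ {A B g} → Edge A B g → Pred Lattice 0ℓ
HalfOpen {A} {B} {g} e P = ∃[ n ] (0ℤ ≤ n × n < + g × P ≡ shift A n (Edge.dir e))

halfOpen-count : ∀ {A B g} (e : Edge A B g) → HasExactly g (HalfOpen e)
halfOpen-count {A} {B} {g} (edge v u bez _) = enumerate (λ i → shift A (+ toℕ i) v)
  (λ eq → Fin.toℕ-injective (ℤ.+-injective (shift-injective A v u bez eq)))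
  (λ i → + toℕ i , ℤ.+≤+ ℕ.z≤n , ℤ.+<+ (Fin.toℕ<n i) , refl)
  (λ P (n , 0≤n , n<g , P≡) → let i , n≡ = toFin 0≤n n<g in
    i , trans P≡ (cong (λ z → shift A z v) n≡))

-- A common point makes m w = (n - g) v, so m times the determinant vanishes. Hence m = 0, the point
-- is B, and n = g contradicts n < g.
halfOpen-disjoint : ∀ {A B C g h} (e : Edge A B g) (f : Edge B C h) → det A B C ≢ 0ℤ →
  ∀ {P} → HalfOpen e P → HalfOpen f P → ⊥
halfOpen-disjoint {A@(a₁ , a₂)} {B} {C} {g} {h} (edge v@(v₁ , v₂) u bez refl) (edge w@(w₁ , w₂) _ _ refl) D≢0
  (n , _ , n<g , refl) (m , _ , _ , eq) = ℤ.<-irrefl n≡g n<g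
  where
  isolate : ∀ a n v g m w → a + n * v ≡ a + g * v + m * w → m * w ≡ (n - g) * v
  isolate a n v g m w eq = trans (id₁ a g v m w) (trans (cong (_- (a + g * v)) (sym eq)) (id₂ a n v g))
    where
    id₁ : ∀ a g v m w → m * w ≡ a + g * v + m * w - (a + g * v)
    id₁ = ℤ-Ring.solve-∀
    id₂ : ∀ a n v g → a + n * v - (a + g * v) ≡ (n - g) * v
    id₂ = ℤ-Ring.solve-∀
  identity : ∀ a₁ a₂ v₁ v₂ w₁ w₂ g h m →
    ((a₁ + g * v₁ - a₁) * (a₂ + g * v₂ + h * w₂ - a₂) - (a₂ + g * v₂ - a₂) * (a₁ + g * v₁ + h * w₁ - a₁)) * m ≡
    g * h * (v₁ * (m * w₂) - v₂ * (m * w₁))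
  identity = ℤ-Ring.solve-∀
  parallel : ∀ c t v₁ v₂ → c * (v₁ * (t * v₂) - v₂ * (t * v₁)) ≡ 0ℤ
  parallel = ℤ-Ring.solve-∀
  Dm≡0 : det A B C * m ≡ 0ℤ
  Dm≡0 = trans (identity a₁ a₂ v₁ v₂ w₁ w₂ (+ g) (+ h) m)
    (trans (cong₂ (λ y x → + g * + h * (v₁ * y - v₂ * x))
        (isolate a₂ n v₂ (+ g) m w₂ (cong proj₂ eq)) (isolate a₁ n v₁ (+ g) m w₁ (cong proj₁ eq)))
      (parallel (+ g * + h) (n - + g) v₁ v₂))
  m≡0 : m ≡ 0ℤ
  m≡0 = [ (λ D≡0 → ⊥-elim (D≢0 D≡0)) , (λ m≡0 → m≡0) ]′ (ℤ.i*j≡0⇒i≡0∨j≡0 (det A B C) Dm≡0)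
  n≡g : n ≡ + g
  n≡g = shift-injective A v u bez (trans eq (trans (cong (λ z → shift B z w) m≡0) (shift-zero B w)))

onEdge-split : ∀ {A B C g h} (e : Edge A B g) (f : Edge B C (suc h)) →
  ∀ {P} → OnEdge e P → HalfOpen e P ⊎ HalfOpen f P
onEdge-split {A} {B} {C} {g} e@(edge v _ _ end) f (n , 0≤n , n≤g , P≡) with n ℤ.≟ + g
... | no  n≢g = inj₁ (n , 0≤n , ℤ.≤∧≢⇒< n≤g n≢g , P≡)
-- The omitted end is the start of the next edge, with parameter 0; the successor length there
-- ensures 0 < h + 1.
... | yes n≡g = inj₂ (0ℤ , ℤ.≤-refl , ℤ.+<+ ℕ.z<s ,
  trans P≡ (trans (cong (λ z → shift A z v) n≡g) (trans (sym end) (sym (shift-zero B (Edge.dir f))))))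

halfOpen⇒onEdge : ∀ {A B g} (e : Edge A B g) {P} → HalfOpen e P → OnEdge e P
halfOpen⇒onEdge e (n , 0≤n , n<g , P≡) = n , 0≤n , ℤ.<⇒≤ n<g , P≡

Boundary Inner : Lattice → Lattice → Lattice → Pred Lattice 0ℓ
Boundary A B C P =
  Segment (ι A) (ι B) (ι P) ⊎ Segment (ι B) (ι C) (ι P) ⊎ Segment (ι C) (ι A) (ι P)
Inner A B C P = Interior (Hull₃ (ι A) (ι B) (ι C)) (ι P)

det-rotate-≢0 : ∀ A B C → det A B C ≢ 0ℤ → det B C A ≢ 0ℤ
det-rotate-≢0 A B C D≢0 D′≡0 = D≢0 (trans (det-rotate A B C) D′≡0)

boundary-count : ∀ {A B C f g h} → det A B C ≢ 0ℤ →
  Edge A B (suc f) → Edge B C (suc g) → Edge C A (suc h) →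
  HasExactly (suc f ℕ.+ (suc g ℕ.+ suc h)) (Boundary A B C)
boundary-count {A} {B} {C} D≢0 e₁ e₂ e₃ = hasExactly-resp
  (λ P → mk⇔
    (λ { (inj₁ on₁) → inj₁ (onEdge⇒segment e₁ (halfOpen⇒onEdge e₁ on₁))
       ; (inj₂ (inj₁ on₂)) → inj₂ (inj₁ (onEdge⇒segment e₂ (halfOpen⇒onEdge e₂ on₂)))
       ; (inj₂ (inj₂ on₃)) → inj₂ (inj₂ (onEdge⇒segment e₃ (halfOpen⇒onEdge e₃ on₃))) })
    (λ { (inj₁ s₁) → case onEdge-split e₁ e₂ (segment⇒onEdge e₁ s₁) of λ
           { (inj₁ on₁) → inj₁ on₁ ; (inj₂ on₂) → inj₂ (inj₁ on₂) }
       ; (inj₂ (inj₁ s₂)) → inj₂ (onEdge-split e₂ e₃ (segment⇒onEdge e₂ s₂))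
       ; (inj₂ (inj₂ s₃)) → case onEdge-split e₃ e₁ (segment⇒onEdge e₃ s₃) of λ
           { (inj₁ on₃) → inj₂ (inj₂ on₃) ; (inj₂ on₁) → inj₁ on₁ } }))
  (hasExactly-⊎
    (λ { on₁ (inj₁ on₂) → halfOpen-disjoint e₁ e₂ D≢0 on₁ on₂
       -- Disjointness is available for consecutive edges only, so this pair is read in the order
       -- CA, AB.
       ; on₁ (inj₂ on₃) → halfOpen-disjoint e₃ e₁ D″≢0 on₃ on₁ })
    (halfOpen-count e₁)
    (hasExactly-⊎ (halfOpen-disjoint e₂ e₃ D′≢0) (halfOpen-count e₂) (halfOpen-count e₃)))
  where
  D′≢0 = det-rotate-≢0 A B C D≢0
  D″≢0 = det-rotate-≢0 B C A D′≢0

-- Primitive directions from Bézout's identity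

sign-factor : ∀ z → ∃[ s ] (z ≡ s * + ∣ z ∣ × s * s ≡ 1ℤ)
sign-factor z with ℤ.+∣i∣≡i⊎+∣i∣≡-i z
... | inj₁ eq = 1ℤ , trans (sym eq) (sym (ℤ.*-identityˡ (+ ∣ z ∣))) , refl
... | inj₂ eq = - 1ℤ , trans (sym (ℤ.neg-involutive z)) (trans (cong -_ (sym eq)) (sym (ℤ.-1*i≡-i (+ ∣ z ∣)))) , refl

bézout-ℤ : ∀ {d m n} → Bézout.Identity d m n → ∃[ x ] ∃[ y ] x * + m + y * + n ≡ + d
bézout-ℤ {d} {m} {n} (Bézout.+- x y eq) = + x , - + y ,
  trans (cong₂ _+_ (trans (sym (ℤ.pos-* x m)) (trans (cong +_ (sym eq)) (trans (ℤ.pos-+ d (y ℕ.* n)) (cong (λ z → + d + z) (ℤ.pos-* y n))))) refl)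
    (identity (+ d) (+ y) (+ n))
  where
  identity : ∀ d y n → d + y * n + (- y) * n ≡ d
  identity = ℤ-Ring.solve-∀
bézout-ℤ {d} {m} {n} (Bézout.-+ x y eq) = - + x , + y ,
  trans (cong (λ z → (- + x) * + m + z) (trans (sym (ℤ.pos-* y n)) (trans (cong +_ (sym eq)) (trans (ℤ.pos-+ d (x ℕ.* m)) (cong (λ z → + d + z) (ℤ.pos-* x m))))))
    (identity (+ d) (+ x) (+ m))
  where
  identity : ∀ d x m → (- x) * m + (d + x * m) ≡ d
  identity = ℤ-Ring.solve-∀

-- Dividing by the gcd of the absolute values gives v up to signs. Restoring the signs both in v and
-- in the Bézout coefficients leaves the pairing at 1, since each sign has square 1.
primitive-direction : ∀ x y → ¬ (x ≡ 0ℤ × y ≡ 0ℤ) →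
  ∃[ g ] Σ[ v ∈ Lattice ] Σ[ u ∈ Lattice ]
    (u ∙ v ≡ 1ℤ × x ≡ + suc g * proj₁ v × y ≡ + suc g * proj₂ v)
primitive-direction x y xy≢0 with Bézout.lemma ∣ x ∣ ∣ y ∣
... | Bézout.result 0 gcd _ = ⊥-elim (xy≢0
  ( ℤ.∣i∣≡0⇒i≡0 (0∣⇒≡0 (proj₁ (GCD.commonDivisor gcd)))
  , ℤ.∣i∣≡0⇒i≡0 (0∣⇒≡0 (proj₂ (GCD.commonDivisor gcd)))))
... | Bézout.result (suc g) gcd b =
  let divides p ∣x∣≡ = proj₁ (GCD.commonDivisor gcd)
      divides q ∣y∣≡ = proj₂ (GCD.commonDivisor gcd)
      s , x≡ , ss = sign-factor x
      t , y≡ , tt = sign-factor y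
      k , l , kl = bézout-ℤ b
  in g , (s * + p , t * + q) , (k * s , l * t) ,
     ℤ.*-cancelʳ-≡ _ 1ℤ (+ suc g) (begin
       (k * s * (s * + p) + l * t * (t * + q)) * + suc g                 ≡⟨ identity k l s t (+ p) (+ q) (+ suc g) ⟩
       k * (s * s) * (+ p * + suc g) + l * (t * t) * (+ q * + suc g)     ≡⟨ cong₂ (λ a b → k * a * (+ p * + suc g) + l * b * (+ q * + suc g)) ss tt ⟩
       k * 1ℤ * (+ p * + suc g) + l * 1ℤ * (+ q * + suc g)               ≡⟨ cong₂ (λ a b → k * 1ℤ * a + l * 1ℤ * b) (sym (trans (cong +_ ∣x∣≡) (ℤ.pos-* p (suc g)))) (sym (trans (cong +_ ∣y∣≡) (ℤ.pos-* q (suc g)))) ⟩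
       k * 1ℤ * + ∣ x ∣ + l * 1ℤ * + ∣ y ∣                               ≡⟨ cong₂ (λ a b → a * + ∣ x ∣ + b * + ∣ y ∣) (ℤ.*-identityʳ k) (ℤ.*-identityʳ l) ⟩
       k * + ∣ x ∣ + l * + ∣ y ∣                                         ≡⟨ kl ⟩
       + suc g                                                           ≡⟨ ℤ.*-identityˡ (+ suc g) ⟨
       1ℤ * + suc g                                                      ∎) ,
     trans x≡ (trans (cong (λ z → s * z) (trans (cong +_ ∣x∣≡) (ℤ.pos-* p (suc g)))) (swap s (+ p) (+ suc g))) ,
     trans y≡ (trans (cong (λ z → t * z) (trans (cong +_ ∣y∣≡) (ℤ.pos-* q (suc g)))) (swap t (+ q) (+ suc g)))
  where
  open ≡-Reasoning
  identity : ∀ k l s t p q g → (k * s * (s * p) + l * t * (t * q)) * g ≡ k * (s * s) * (p * g) + l * (t * t) * (q * g)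
  identity = ℤ-Ring.solve-∀
  swap : ∀ s p g → s * (p * g) ≡ g * (s * p)
  swap = ℤ-Ring.solve-∀

edge-exists : ∀ A B → A ≢ B → ∃[ g ] Edge A B (suc g)
edge-exists A@(a₁ , a₂) B@(b₁ , b₂) A≢B =
  let g , v , u , bez , eq₁ , eq₂ = primitive-direction (b₁ - a₁) (b₂ - a₂)
        (λ (z₁ , z₂) → A≢B (cong₂ _,_ (sym (ℤ.i-j≡0⇒i≡j b₁ a₁ z₁)) (sym (ℤ.i-j≡0⇒i≡j b₂ a₂ z₂))))
  in g , edge v u bez (cong₂ _,_ (trans (restore a₁ b₁) (cong (λ z → a₁ + z) eq₁)) (trans (restore a₂ b₂) (cong (λ z → a₂ + z) eq₂)))
  where
  restore : ∀ a b → b ≡ a + (b - a)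
  restore = ℤ-Ring.solve-∀

-- Nondegeneracy is stated through lines, so a vanishing determinant must produce one even when
-- vertices coincide: AB if B ≠ A, else AC if C ≠ A, else the vertical line through A.
det≡0⇒collinear : ∀ A B C → det A B C ≡ 0ℤ →
  Σ[ ℓ ∈ Line ] (OnLine ℓ (ι A) × OnLine ℓ (ι B) × OnLine ℓ (ι C))
det≡0⇒collinear A@(a₁ , a₂) B@(b₁ , b₂) C@(c₁ , c₂) D≡0
  with (b₂ - a₂ ℤ.≟ 0ℤ) ×-dec (a₁ - b₁ ℤ.≟ 0ℤ) | (c₂ - a₂ ℤ.≟ 0ℤ) ×-dec (a₁ - c₁ ℤ.≟ 0ℤ)
... | no B≢A | _ =
  let ℓ , on = integral-line (b₂ - a₂) (a₁ - b₁) _ B≢A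
  in ℓ , on A refl , on B (onB a₁ a₂ b₁ b₂) ,
     on C (trans (onC a₁ a₂ b₁ b₂ c₁ c₂) (trans (cong (λ z → (b₂ - a₂ , a₁ - b₁) ∙ A - z) D≡0) (ℤ.+-identityʳ _)))
  where
  onB : ∀ a₁ a₂ b₁ b₂ → (b₂ - a₂) * b₁ + (a₁ - b₁) * b₂ ≡ (b₂ - a₂) * a₁ + (a₁ - b₁) * a₂
  onB = ℤ-Ring.solve-∀
  onC : ∀ a₁ a₂ b₁ b₂ c₁ c₂ → (b₂ - a₂) * c₁ + (a₁ - b₁) * c₂ ≡
    (b₂ - a₂) * a₁ + (a₁ - b₁) * a₂ - ((b₁ - a₁) * (c₂ - a₂) - (b₂ - a₂) * (c₁ - a₁))
  onC = ℤ-Ring.solve-∀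
... | yes _ | no C≢A =
  let ℓ , on = integral-line (c₂ - a₂) (a₁ - c₁) _ C≢A
  in ℓ , on A refl ,
     on B (trans (onB a₁ a₂ b₁ b₂ c₁ c₂) (trans (cong (λ z → (c₂ - a₂ , a₁ - c₁) ∙ A + z) D≡0) (ℤ.+-identityʳ _))) ,
     on C (onC a₁ a₂ c₁ c₂)
  where
  onC : ∀ a₁ a₂ b₁ b₂ → (b₂ - a₂) * b₁ + (a₁ - b₁) * b₂ ≡ (b₂ - a₂) * a₁ + (a₁ - b₁) * a₂
  onC = ℤ-Ring.solve-∀
  onB : ∀ a₁ a₂ b₁ b₂ c₁ c₂ → (c₂ - a₂) * b₁ + (a₁ - c₁) * b₂ ≡
    (c₂ - a₂) * a₁ + (a₁ - c₁) * a₂ + ((b₁ - a₁) * (c₂ - a₂) - (b₂ - a₂) * (c₁ - a₁))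
  onB = ℤ-Ring.solve-∀
... | yes (_ , B≡A) | yes (_ , C≡A) =
  let ℓ , on = integral-line 1ℤ 0ℤ a₁ λ ()
  in ℓ , on A (first a₁ a₂) ,
     on B (trans (first b₁ b₂) (sym (ℤ.i-j≡0⇒i≡j a₁ b₁ B≡A))) ,
     on C (trans (first c₁ c₂) (sym (ℤ.i-j≡0⇒i≡j a₁ c₁ C≡A)))
  where
  first : ∀ x y → 1ℤ * x + 0ℤ * y ≡ x
  first = ℤ-Ring.solve-∀

-- The triangle (0,0), (2,0), (x,h)

-- Up to a factor 2 in the first condition these are the determinants of the point with the three
-- sides. The offset c = i h - j x grows by h from one lattice point of a row to the next, and the
-- triangle cuts out 0 < c < 2 h - 2 j.
Inside : ℤ → ℤ → Pred Lattice 0ℓ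
Inside h x (i , j) = 0ℤ < j × 0ℤ < i * h - j * x × 0ℤ < + 2 * h - + 2 * j - (i * h - j * x)

-- On the line i h = j x the Bézout relation gives j = h (p i + q j), a multiple of h strictly
-- between 0 and h. Shifting i treats the parallel line through (1,0); shifting i and x by 2 treats
-- the side from (2,0).
off-side : ∀ {h x} p q → 0ℤ < h → p * x + q * h ≡ 1ℤ → ∀ i {j} → 0ℤ < j → 0ℤ < h - j →
  i * h - j * x ≢ 0ℤ
off-side {h} {x} p q 0<h bez i {j} 0<j 0<h-j on =
  0<hz<h-absurd {h} {p * i + j * q} 0<h (0<-resp j≡ 0<j) (0<-resp (cong (λ z → h - z) j≡) 0<h-j)
  where
  identity : ∀ h x p q i j → h * (p * i + j * q) ≡ j * (p * x + q * h) + p * (i * h - j * x)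
  identity = ℤ-Ring.solve-∀
  simplify : ∀ j p → j * 1ℤ + p * 0ℤ ≡ j
  simplify = ℤ-Ring.solve-∀
  j≡ : j ≡ h * (p * i + j * q)
  j≡ = sym (trans (identity h x p q i j) (trans (cong₂ (λ a b → j * a + p * b) bez on) (simplify j p)))

-- For 0 < j < h there is a unique i with 0 < i h − j x < h.  Exactly one of (i , j) and its reflection
-- (x + 2 − i , h − j) through the midpoint of (2,0) and (x,h) lies inside, so interior points
-- correspond to rows.
module Rows (k : ℕ) (x p q p′ q′ : ℤ) (h : ℤ) (h≡ : h ≡ + suc k)
  (bez : p * x + q * h ≡ 1ℤ) (bez′ : p′ * (x - + 2) + q′ * h ≡ 1ℤ) where

  private
    0<h : 0ℤ < h
    0<h = subst (0ℤ <_) (sym h≡) (ℤ.+<+ ℕ.z<s)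

    infixl 1 _by_
    _by_ : ∀ {a b} → 0ℤ < a → a ≡ b → 0ℤ < b
    lt by eq = 0<-resp eq lt

    absurd : ∀ {a} → 0ℤ < a → a ≡ 0ℤ → ⊥
    absurd lt eq = ℤ.<-irrefl (sym eq) lt

  -- The line c = h through (1,0), where c = i h - j x, halves the parallelogram. An interior point
  -- with c < h stands for its own row; one with c > h is the half-turn image of a point of row r
  -- and stands for r.
  Represents : ℤ → Lattice → Set
  Represents r (i , j) = Inside h x (i , j) ×
    ((0ℤ < h - (i * h - j * x) × j ≡ r) ⊎ (0ℤ < (i * h - j * x) - h × j ≡ h - r))

  residue : ∀ {j} → 0ℤ < j → 0ℤ < h - j →
    ∃[ i ] (0ℤ < (i * h - j * x) × 0ℤ < h - (i * h - j * x))
  -- Here e is the floor of j x / h, so the offset is h minus the remainder; remainder 0 would put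
  -- (e , j) on a side.
  residue {j} 0<j 0<h-j = 1ℤ + e ,
    (<⇒0<- (ℤ.+<+ (n%ℕd<d (j * x) (suc k))) by trans (cong (_- + r) (sym h≡)) (sym offset≡)) ,
    (0<r r jx≡ by trans (cancel h (+ r)) (cong (λ z → h - z) (sym offset≡)))
    where
    r = (j * x) %ℕ suc k
    e = (j * x) /ℕ suc k
    jx≡ : j * x ≡ + r + e * h
    jx≡ = trans (a≡a%ℕn+[a/ℕn]*n (j * x) (suc k)) (cong (λ z → + r + e * z) (sym h≡))
    identity : ∀ h e r → (1ℤ + e) * h - (r + e * h) ≡ h - r
    identity = ℤ-Ring.solve-∀
    offset≡ : ((1ℤ + e) * h - j * x) ≡ h - + r
    offset≡ = trans (cong (λ z → (1ℤ + e) * h - z) jx≡) (identity h e (+ r))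
    cancel : ∀ h r → r ≡ h - (h - r)
    cancel = ℤ-Ring.solve-∀
    vanish : ∀ e h → e * h - (0ℤ + e * h) ≡ 0ℤ
    vanish = ℤ-Ring.solve-∀
    0<r : ∀ r → j * x ≡ + r + e * h → 0ℤ < + r
    0<r (suc _) _ = ℤ.+<+ ℕ.z<s
    0<r 0 eq = ⊥-elim (off-side p q 0<h bez e 0<j 0<h-j
      (trans (cong (λ z → e * h - z) eq) (vanish e h)))

  no-smaller : ∀ {i i′ j} → 0ℤ < h - ((i′ * h - j * x) - (i * h - j * x)) → ¬ (i < i′)
  no-smaller {i} {i′} {j} lt i<i′ = 0<z<1-absurd (<⇒0<- i<i′)
    (0<*-cancelˡ {h} {1ℤ - (i′ - i)} 0<h (lt by ℤ-Ring.solve (h ∷ x ∷ i ∷ i′ ∷ j ∷ [])))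

  -- Offsets within a row differ by multiples of h, so a difference below h in both directions is
  -- zero.
  same-row : ∀ {i i′ j} → 0ℤ < h - ((i * h - j * x) - (i′ * h - j * x)) →
    0ℤ < h - ((i′ * h - j * x) - (i * h - j * x)) → i ≡ i′
  same-row {i} {i′} {j} lt lt′ with ℤ.<-cmp i i′
  ... | tri≈ _ i≡i′ _ = i≡i′
  ... | tri< i<i′ _ _ = ⊥-elim (no-smaller {i} {i′} {j} lt′ i<i′)
  ... | tri> _ _ i′<i = ⊥-elim (no-smaller {i′} {i} {j} lt i′<i)

  reflected-inside : ∀ {i r} → 0ℤ < h - r → 0ℤ < h - (i * h - r * x) →
    + 2 * h - + 2 * r - (i * h - r * x) < 0ℤ → Represents r (x + + 2 - i , h - r)
  reflected-inside {i} {r} 0<h-r c<h outside =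
    (0<h-r
      , (0<+ 0<h c<h by ℤ-Ring.solve (h ∷ x ∷ i ∷ r ∷ []))
      , (<⇒0<- outside by ℤ-Ring.solve (h ∷ x ∷ i ∷ r ∷ []))) ,
    inj₂ ((c<h by ℤ-Ring.solve (h ∷ x ∷ i ∷ r ∷ [])) , refl)

  represented : ∀ {r} → 0ℤ < r → 0ℤ < h - r → Σ[ P ∈ Lattice ] Represents r P
  represented {r} 0<r 0<h-r with residue 0<r 0<h-r
  ... | i , 0<c , c<h with ℤ.<-cmp 0ℤ (+ 2 * h - + 2 * r - (i * h - r * x))
  ... | tri< inside _ _ = (i , r) , (0<r , 0<c , inside) , inj₁ (c<h , refl)
  ... | tri≈ _ on _ = ⊥-elim (off-side p′ q′ 0<h bez′ (i - + 2) 0<r 0<h-r (trans (identity h x i r) (cong -_ (sym on))))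
    where
    identity : ∀ h x i r → (i - + 2) * h - r * (x - + 2) ≡ - (+ 2 * h - + 2 * r - (i * h - r * x))
    identity = ℤ-Ring.solve-∀
  ... | tri> _ _ outside = (x + + 2 - i , h - r) , reflected-inside 0<h-r c<h outside

  -- The half-turn brings the second point into row r within distance h of the first offset, so by
  -- `same-row` the points are mirror images. Their determinants with the side joining (2,0) and
  -- (x,h) are then opposite, yet both positive.
  opposite-halves : ∀ {i i′ r} → Inside h x (i , r) → 0ℤ < h - (i * h - r * x) →
    Inside h x (i′ , h - r) → 0ℤ < (i′ * h - (h - r) * x) - h → ⊥
  opposite-halves {i} {i′} {r} (0<r , 0<c , in₁) c<h (0<r′ , 0<c′ , in₂) h<c′ =
    absurd (0<+ in₁ in₂) (trans (sum h x i i′ r)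
      (trans (cong (λ z → (x + + 2 - z - i′) * h) i≡) (vanish x h i′)))
    where
    i≡ : i ≡ x + + 2 - i′
    i≡ = same-row {i} {x + + 2 - i′} {r}
      (0<+ c<h (0<+ in₂ (0<+ 0<r′ 0<r′)) by ℤ-Ring.solve (h ∷ x ∷ i ∷ i′ ∷ r ∷ []))
      (0<+ h<c′ 0<c by ℤ-Ring.solve (h ∷ x ∷ i ∷ i′ ∷ r ∷ []))
    sum : ∀ h x i i′ r → + 2 * h - + 2 * r - (i * h - r * x) + (+ 2 * h - + 2 * (h - r) - (i′ * h - (h - r) * x)) ≡
      (x + + 2 - i - i′) * h
    sum = ℤ-Ring.solve-∀
    vanish : ∀ x h i′ → (x + + 2 - (x + + 2 - i′) - i′) * h ≡ 0ℤ
    vanish = ℤ-Ring.solve-∀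

  representative-unique : ∀ {r P Q} → Represents r P → Represents r Q → P ≡ Q
  representative-unique {P = i , j} {i′ , j′} ((0<j , 0<c , _) , inj₁ (c<h , refl)) ((_ , 0<c′ , _) , inj₁ (c′<h , refl)) =
    cong (_, j) (same-row {i} {i′} {j}
      (0<+ c<h 0<c′ by ℤ-Ring.solve (h ∷ x ∷ i ∷ i′ ∷ j ∷ []))
      (0<+ c′<h 0<c by ℤ-Ring.solve (h ∷ x ∷ i ∷ i′ ∷ j ∷ [])))
  representative-unique {r} {P = i , j} {i′ , j′} ((0<j , _ , in₁) , inj₂ (h<c , refl)) ((_ , _ , in₂) , inj₂ (h<c′ , refl)) =
    cong (_, h - r) (same-row {i} {i′} {h - r}
      (0<+ (0<+ in₁ h<c′) (0<+ 0<j 0<j) by ℤ-Ring.solve (h ∷ x ∷ i ∷ i′ ∷ r ∷ []))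
      (0<+ (0<+ in₂ h<c) (0<+ 0<j 0<j) by ℤ-Ring.solve (h ∷ x ∷ i ∷ i′ ∷ r ∷ [])))
  representative-unique {P = P} {Q} (in₁ , inj₁ (c<h , refl)) (in₂ , inj₂ (h<c , refl)) =
    ⊥-elim (opposite-halves {proj₁ P} {proj₁ Q} in₁ c<h in₂ h<c)
  representative-unique {P = P} {Q} (in₁ , inj₂ (h<c , refl)) (in₂ , inj₁ (c<h , refl)) =
    ⊥-elim (opposite-halves {proj₁ Q} {proj₁ P} in₂ c<h in₁ h<c)

  row-unique : ∀ {r r′ P} → Represents r P → Represents r′ P → r ≡ r′
  row-unique (_ , inj₁ (_ , j≡r)) (_ , inj₁ (_ , j≡r′)) = trans (sym j≡r) j≡r′
  row-unique {r} {r′} (_ , inj₂ (_ , j≡)) (_ , inj₂ (_ , j≡′)) =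
    trans (involutive h r) (trans (cong (λ z → h - z) (trans (sym j≡) j≡′)) (sym (involutive h r′)))
    where
    involutive : ∀ h r → r ≡ h - (h - r)
    involutive = ℤ-Ring.solve-∀
  row-unique {P = i , j} (_ , inj₁ (c<h , _)) (_ , inj₂ (h<c , _)) = ⊥-elim (absurd (0<+ c<h h<c) (opposite h (i * h - j * x)))
    where
    opposite : ∀ h c → h - c + (c - h) ≡ 0ℤ
    opposite = ℤ-Ring.solve-∀
  row-unique {P = i , j} (_ , inj₂ (h<c , _)) (_ , inj₁ (c<h , _)) = ⊥-elim (absurd (0<+ c<h h<c) (opposite h (i * h - j * x)))
    where
    opposite : ∀ h c → h - c + (c - h) ≡ 0ℤ
    opposite = ℤ-Ring.solve-∀

  below-apex : ∀ {P} → Inside h x P → 0ℤ < h - proj₂ P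
  below-apex {i , j} (_ , 0<c , in₁) =
    0<*-cancelˡ {+ 2} (ℤ.+<+ ℕ.z<s) (0<+ 0<c in₁ by ℤ-Ring.solve (h ∷ x ∷ i ∷ j ∷ []))

  represents : ∀ {P} → Inside h x P → ∃[ r ] (0ℤ < r × 0ℤ < h - r × Represents r P)
  represents {i , j} inside@(0<j , 0<c , _) with ℤ.<-cmp ((i * h - j * x)) h
  ... | tri< c<h _ _ = j , 0<j , below-apex {i , j} inside , inside , inj₁ (<⇒0<- c<h , refl)
  ... | tri≈ _ c≡h _ = ⊥-elim (off-side p q 0<h bez (i - 1ℤ) 0<j (below-apex {i , j} inside)
    (trans (identity h x i j) (ℤ.i≡j⇒i-j≡0 c≡h)))
    where
    identity : ∀ h x i j → (i - 1ℤ) * h - j * x ≡ i * h - j * x - h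
    identity = ℤ-Ring.solve-∀
  ... | tri> _ _ h<c = h - j , below-apex {i , j} inside , (0<j by involutive h j) , inside ,
    inj₂ (<⇒0<- h<c , involutive h j)
    where
    involutive : ∀ h r → r ≡ h - (h - r)
    involutive = ℤ-Ring.solve-∀

  inside-count : HasExactly k (Inside h x)
  inside-count = enumerate
    (λ m → proj₁ (chosen m))
    (λ {m} {m′} eq → Fin.toℕ-injective (ℕ.suc-injective (ℤ.+-injective
      (row-unique {P = proj₁ (chosen m′)} (subst (Represents (row m)) eq (proj₂ (chosen m))) (proj₂ (chosen m′))))))
    (λ m → proj₁ (proj₂ (chosen m)))
    (λ P inside → let r , 0<r , 0<h-r , rep = represents {P} inside
                      m , r≡ = index 0<r 0<h-r
                  in m , representative-unique {P = P} {proj₁ (chosen m)} (subst (λ z → Represents z P) r≡ rep) (proj₂ (chosen m)))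
    where
    row : Fin k → ℤ
    row m = + suc (toℕ m)
    chosen : ∀ m → Σ[ P ∈ Lattice ] Represents (row m) P
    chosen m = represented (ℤ.+<+ ℕ.z<s)
      (subst (λ z → 0ℤ < z - row m) (sym h≡) (<⇒0<- (ℤ.+<+ (ℕ.s<s (Fin.toℕ<n m)))))
    index : ∀ {r} → 0ℤ < r → 0ℤ < h - r → Σ[ m ∈ Fin k ] r ≡ row m
    index {+ suc n} _ 0<h-r with subst (+ suc n <_) h≡ (0<-⇒< 0<h-r)
    ... | ℤ.+<+ (ℕ.s<s n<k) = fromℕ< n<k , cong (λ z → + suc z) (sym (Fin.toℕ-fromℕ< n<k))
    index {+ 0} (ℤ.+<+ ()) _

edge-dual : ∀ {A B} (e : Edge A B 1) → Edge.dual e ∙ diff A B ≡ 1ℤ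
edge-dual {A} (edge v u bez end) =
  trans (cong (λ P → u ∙ diff A P) end) (dual-shift A (+ 1) v u bez)

dets⇔inside : ∀ i j h x {d₁ d₂ d₃} → d₁ ≡ + 2 * j → d₂ ≡ + 2 * h - + 2 * j - d₃ → d₃ ≡ i * h - j * x →
  (0ℤ < d₁ × 0ℤ < d₂ × 0ℤ < d₃) ⇔ Inside h x (i , j)
dets⇔inside i j h x refl refl refl = mk⇔
  (λ (0<2j , 0<b , 0<c) → 0<*-cancelˡ {+ 2} (ℤ.+<+ ℕ.z<s) 0<2j , 0<c , 0<b)
  (λ (0<j , 0<c , 0<b) → 0<-resp (double j) (0<+ 0<j 0<j) , 0<b , 0<c)
  where
  double : ∀ z → z + z ≡ + 2 * z
  double = ℤ-Ring.solve-∀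

-- Adding j to either slanted side condition makes it a multiple of h; dividing by h leaves 0 < i -
-- j m < 2.
inside-median : ∀ i j h m {x} → 0ℤ < h → x ≡ 1ℤ + h * m → Inside h x (i , j) → i - j * m ≡ 1ℤ
inside-median i j h m 0<h refl (0<j , 0<c , 0<b) = squeeze
  (0<*-cancelˡ 0<h (0<-resp (lower h m i j) (0<+ 0<c 0<j)))
  (0<*-cancelˡ 0<h (0<-resp (upper h m i j) (0<+ 0<b 0<j)))
  where
  lower : ∀ h m i j → i * h - j * (1ℤ + h * m) + j ≡ h * (i - j * m)
  lower = ℤ-Ring.solve-∀
  upper : ∀ h m i j → + 2 * h - + 2 * j - (i * h - j * (1ℤ + h * m)) + j ≡ h * (+ 2 - (i - j * m))
  upper = ℤ-Ring.solve-∀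
  squeeze : ∀ {z} → 0ℤ < z → 0ℤ < + 2 - z → z ≡ 1ℤ
  squeeze {+ 0} (ℤ.+<+ ()) _
  squeeze {+ 1} _ _ = refl
  squeeze {+ suc (suc n)} _ lt = ⊥-elim (0<z<1-absurd {+ suc n} (ℤ.+<+ ℕ.z<s) (0<-resp (shift-one (+ suc n)) lt))
    where
    shift-one : ∀ z → + 2 - (1ℤ + z) ≡ 1ℤ - z
    shift-one = ℤ-Ring.solve-∀

-- Coordinates with origin A and basis v , (− u₂ , u₁), which is unimodular since u ∙ v = 1.
module Frame (a₁ a₂ c₁ c₂ v₁ v₂ u₁ u₂ : ℤ) (bez : u₁ * v₁ + u₂ * v₂ ≡ 1ℤ) where

  A B C : Lattice
  A = a₁ , a₂
  B = shift A (+ 2) (v₁ , v₂)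
  C = c₁ , c₂

  coordinates position : Lattice → Lattice
  coordinates (x , y) = u₁ * (x - a₁) + u₂ * (y - a₂) , v₁ * (y - a₂) - v₂ * (x - a₁)
  position (i , j) = a₁ + (i * v₁ - j * u₂) , a₂ + (i * v₂ + j * u₁)

  apex height : ℤ
  apex = proj₁ (coordinates C)
  height = proj₂ (coordinates C)

  private
    -- Identities that depend on u ∙ v = 1 are proved as polynomial identities with the factor u ∙ v
    -- written out, which is then replaced by 1.
    via-bez : ∀ {z w} → z ≡ (u₁ * v₁ + u₂ * v₂) * w → z ≡ w
    via-bez {w = w} eq = trans eq (trans (cong (λ t → t * w) bez) (ℤ.*-identityˡ w))

  coordinates-position : ∀ P → coordinates (position P) ≡ P
  coordinates-position (i , j) = cong₂ _,_
    (via-bez (identity₁ a₁ a₂ v₁ v₂ u₁ u₂ i j)) (via-bez (identity₂ a₁ a₂ v₁ v₂ u₁ u₂ i j))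
    where
    identity₁ : ∀ a₁ a₂ v₁ v₂ u₁ u₂ i j →
      u₁ * (a₁ + (i * v₁ - j * u₂) - a₁) + u₂ * (a₂ + (i * v₂ + j * u₁) - a₂) ≡ (u₁ * v₁ + u₂ * v₂) * i
    identity₁ = ℤ-Ring.solve-∀
    identity₂ : ∀ a₁ a₂ v₁ v₂ u₁ u₂ i j →
      v₁ * (a₂ + (i * v₂ + j * u₁) - a₂) - v₂ * (a₁ + (i * v₁ - j * u₂) - a₁) ≡ (u₁ * v₁ + u₂ * v₂) * j
    identity₂ = ℤ-Ring.solve-∀

  position-coordinates : ∀ P → position (coordinates P) ≡ P
  position-coordinates (x , y) = cong₂ _,_
    (trans (cong (λ z → a₁ + z) (via-bez (identity₁ a₁ a₂ v₁ v₂ u₁ u₂ x y))) (restore a₁ x))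
    (trans (cong (λ z → a₂ + z) (via-bez (identity₂ a₁ a₂ v₁ v₂ u₁ u₂ x y))) (restore a₂ y))
    where
    identity₁ : ∀ a₁ a₂ v₁ v₂ u₁ u₂ x y →
      (u₁ * (x - a₁) + u₂ * (y - a₂)) * v₁ - (v₁ * (y - a₂) - v₂ * (x - a₁)) * u₂ ≡ (u₁ * v₁ + u₂ * v₂) * (x - a₁)
    identity₁ = ℤ-Ring.solve-∀
    identity₂ : ∀ a₁ a₂ v₁ v₂ u₁ u₂ x y →
      (u₁ * (x - a₁) + u₂ * (y - a₂)) * v₂ + (v₁ * (y - a₂) - v₂ * (x - a₁)) * u₁ ≡ (u₁ * v₁ + u₂ * v₂) * (y - a₂)
    identity₂ = ℤ-Ring.solve-∀
    restore : ∀ a x → a + (x - a) ≡ x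
    restore = ℤ-Ring.solve-∀

  det-height : det A B C ≡ + 2 * height
  det-height = identity a₁ a₂ c₁ c₂ v₁ v₂
    where
    identity : ∀ a₁ a₂ c₁ c₂ v₁ v₂ →
      (a₁ + + 2 * v₁ - a₁) * (c₂ - a₂) - (a₂ + + 2 * v₂ - a₂) * (c₁ - a₁) ≡ + 2 * (v₁ * (c₂ - a₂) - v₂ * (c₁ - a₁))
    identity = ℤ-Ring.solve-∀

  0<height : 0ℤ < det A B C → 0ℤ < height
  0<height 0<D = 0<*-cancelˡ {+ 2} {height} (ℤ.+<+ ℕ.z<s) (0<-resp det-height 0<D)

  -- The dual vector w of the edge pairs to 1 with A - C. The coefficients are its values on the
  -- basis vectors, negated because the edge runs from C to A.
  apex-bézout : Edge C A 1 → ∃[ p ] ∃[ q ] p * apex + q * height ≡ 1ℤ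
  apex-bézout e = - (w₁ * v₁ + w₂ * v₂) , w₁ * u₂ - w₂ * u₁ ,
    trans (via-bez (identity a₁ a₂ c₁ c₂ v₁ v₂ u₁ u₂ w₁ w₂)) (edge-dual e)
    where
    w₁ = proj₁ (Edge.dual e)
    w₂ = proj₂ (Edge.dual e)
    identity : ∀ a₁ a₂ c₁ c₂ v₁ v₂ u₁ u₂ w₁ w₂ →
      - (w₁ * v₁ + w₂ * v₂) * (u₁ * (c₁ - a₁) + u₂ * (c₂ - a₂)) + (w₁ * u₂ - w₂ * u₁) * (v₁ * (c₂ - a₂) - v₂ * (c₁ - a₁)) ≡
      (u₁ * v₁ + u₂ * v₂) * (w₁ * (a₁ - c₁) + w₂ * (a₂ - c₂))
    identity = ℤ-Ring.solve-∀

  apex-bézout′ : Edge B C 1 → ∃[ p ] ∃[ q ] p * (apex - + 2) + q * height ≡ 1ℤ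
  apex-bézout′ e = w₁ * v₁ + w₂ * v₂ , w₂ * u₁ - w₁ * u₂ ,
    trans (identity a₁ a₂ c₁ c₂ v₁ v₂ u₁ u₂ w₁ w₂)
      -- The first coordinate of B is 2 (u ∙ v), which is 2 only by the Bézout relation; the
      -- identity carries the discrepancy as a correction term that vanishes here.
      (trans (cong (λ t → t * (Edge.dual e ∙ diff B C) + + 2 * (t - 1ℤ) * (w₁ * v₁ + w₂ * v₂)) bez)
        (trans (simplify (Edge.dual e ∙ diff B C) (w₁ * v₁ + w₂ * v₂)) (edge-dual e)))
    where
    w₁ = proj₁ (Edge.dual e)
    w₂ = proj₂ (Edge.dual e)
    identity : ∀ a₁ a₂ c₁ c₂ v₁ v₂ u₁ u₂ w₁ w₂ →
      (w₁ * v₁ + w₂ * v₂) * (u₁ * (c₁ - a₁) + u₂ * (c₂ - a₂) - + 2) + (w₂ * u₁ - w₁ * u₂) * (v₁ * (c₂ - a₂) - v₂ * (c₁ - a₁)) ≡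
      (u₁ * v₁ + u₂ * v₂) * (w₁ * (c₁ - (a₁ + + 2 * v₁)) + w₂ * (c₂ - (a₂ + + 2 * v₂))) +
      + 2 * (u₁ * v₁ + u₂ * v₂ - 1ℤ) * (w₁ * v₁ + w₂ * v₂)
    identity = ℤ-Ring.solve-∀
    simplify : ∀ s t → 1ℤ * s + + 2 * (1ℤ - 1ℤ) * t ≡ s
    simplify = ℤ-Ring.solve-∀

  inner⇔inside : 0ℤ < det A B C → ∀ P → Inner A B C P ⇔ Inside height apex (coordinates P)
  inner⇔inside 0<D P@(x , y) =
    dets⇔inside (proj₁ (coordinates P)) (proj₂ (coordinates P)) height apex
      (identity₁ a₁ a₂ v₁ v₂ x y)
      (identity₃ a₁ a₂ c₁ c₂ v₁ v₂ x y)
      (sym (via-bez (identity₂ a₁ a₂ c₁ c₂ v₁ v₂ u₁ u₂ x y)))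
    ⇔-∘ interior⇔dets {A} {B} {C} 0<D P
    where
    identity₁ : ∀ a₁ a₂ v₁ v₂ x y →
      (a₁ + + 2 * v₁ - a₁) * (y - a₂) - (a₂ + + 2 * v₂ - a₂) * (x - a₁) ≡ + 2 * (v₁ * (y - a₂) - v₂ * (x - a₁))
    identity₁ = ℤ-Ring.solve-∀
    identity₂ : ∀ a₁ a₂ c₁ c₂ v₁ v₂ u₁ u₂ x y →
      (u₁ * (x - a₁) + u₂ * (y - a₂)) * (v₁ * (c₂ - a₂) - v₂ * (c₁ - a₁)) -
      (v₁ * (y - a₂) - v₂ * (x - a₁)) * (u₁ * (c₁ - a₁) + u₂ * (c₂ - a₂)) ≡
      (u₁ * v₁ + u₂ * v₂) * ((a₁ - c₁) * (y - c₂) - (a₂ - c₂) * (x - c₁))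
    identity₂ = ℤ-Ring.solve-∀
    identity₃ : ∀ a₁ a₂ c₁ c₂ v₁ v₂ x y →
      (c₁ - (a₁ + + 2 * v₁)) * (y - (a₂ + + 2 * v₂)) - (c₂ - (a₂ + + 2 * v₂)) * (x - (a₁ + + 2 * v₁)) ≡
      + 2 * (v₁ * (c₂ - a₂) - v₂ * (c₁ - a₁)) - + 2 * (v₁ * (y - a₂) - v₂ * (x - a₁)) -
      ((a₁ - c₁) * (y - c₂) - (a₂ - c₂) * (x - c₁))
    identity₃ = ℤ-Ring.solve-∀

  inner-count : ∀ {k} → 0ℤ < det A B C → Edge B C 1 → Edge C A 1 → height ≡ + suc k →
    HasExactly k (Inner A B C)
  inner-count {k} 0<D e e′ h≡ =
    let p , q , pq = apex-bézout e′
        p′ , q′ , pq′ = apex-bézout′ e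
    in hasExactly-resp (λ P → ⇔-sym (inner⇔inside 0<D P))
      (hasExactly-bijection position coordinates position-coordinates coordinates-position
        (Rows.inside-count k apex p q p′ q′ height h≡ pq pq′))

  height-suc : 0ℤ < det A B C → ∃[ k ] height ≡ + suc k
  height-suc 0<D = positive-suc (0<height 0<D)
    where
    positive-suc : ∀ {z} → 0ℤ < z → ∃[ k ] z ≡ + suc k
    positive-suc {+ suc k} _ = k , refl
    positive-suc {+ 0} (ℤ.+<+ ())

  -- When apex ≡ 1 modulo height, the median from C is, after a shear, the line of interior points.
  inner-collinear : ∀ m → 0ℤ < det A B C → apex ≡ 1ℤ + height * m → Collinear (Inner A B C)
  inner-collinear m 0<D apex≡ =
    let ℓ , on = integral-line n₁ n₂ (1ℤ + (n₁ , n₂) ∙ A) nontrivial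
    in ℓ , λ P inner → on P (equation P (to (inner⇔inside 0<D P) inner))
    where
    -- The coefficients of i - j m in the original coordinates; this normal pairs to 1 with v, hence
    -- is nonzero.
    n₁ = u₁ + m * v₂
    n₂ = u₂ - m * v₁
    identity₀ : ∀ v₁ v₂ u₁ u₂ m → (u₁ + m * v₂) * v₁ + (u₂ - m * v₁) * v₂ ≡ u₁ * v₁ + u₂ * v₂
    identity₀ = ℤ-Ring.solve-∀
    zero-form : ∀ v₁ v₂ → 0ℤ * v₁ + 0ℤ * v₂ ≡ 0ℤ
    zero-form = ℤ-Ring.solve-∀
    nontrivial : ¬ (n₁ ≡ 0ℤ × n₂ ≡ 0ℤ)
    nontrivial (n₁≡0 , n₂≡0) = case trans (sym (trans (identity₀ v₁ v₂ u₁ u₂ m) bez))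
      (trans (cong₂ (λ s t → s * v₁ + t * v₂) n₁≡0 n₂≡0) (zero-form v₁ v₂)) of λ ()
    identity₁ : ∀ a₁ a₂ v₁ v₂ u₁ u₂ m x y →
      (u₁ + m * v₂) * x + (u₂ - m * v₁) * y ≡
      (u₁ * (x - a₁) + u₂ * (y - a₂)) - (v₁ * (y - a₂) - v₂ * (x - a₁)) * m + ((u₁ + m * v₂) * a₁ + (u₂ - m * v₁) * a₂)
    identity₁ = ℤ-Ring.solve-∀
    equation : ∀ P → Inside height apex (coordinates P) → (n₁ , n₂) ∙ P ≡ 1ℤ + (n₁ , n₂) ∙ A
    equation P@(x , y) inside =
      trans (identity₁ a₁ a₂ v₁ v₂ u₁ u₂ m x y) (cong (λ z → z + (n₁ , n₂) ∙ A)
        (inside-median (proj₁ (coordinates P)) (proj₂ (coordinates P)) height m (0<height 0<D) apex≡ inside))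

-- Residues of the apex

common-divisor-absurd : ∀ {p q x h s t} d → 1ℤ < d → x ≡ d * s → h ≡ d * t → p * x + q * h ≢ 1ℤ
common-divisor-absurd {p} {q} {s = s} {t} d 1<d refl refl eq =
  0<hz<h-absurd {d} {p * s + q * t} (ℤ.<-trans (ℤ.+<+ ℕ.z<s) 1<d)
    (0<-resp (trans (sym eq) (factor d p q s t)) (ℤ.+<+ ℕ.z<s))
    (0<-resp (cong (λ z → d - z) (trans (sym eq) (factor d p q s t))) (<⇒0<- 1<d))
  where
  factor : ∀ d p q s t → p * (d * s) + q * (d * t) ≡ d * (p * s + q * t)
  factor = ℤ-Ring.solve-∀

1<2 : 1ℤ < + 2
1<2 = ℤ.+<+ (ℕ.s<s ℕ.z<s)

1<3 : 1ℤ < + 3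
1<3 = ℤ.+<+ (ℕ.s<s ℕ.z<s)

Rigid : ℕ → Set
Rigid k = k ≡ 1 ⊎ k ≡ 2 ⊎ k ≡ 5

-- For every residue r ≠ 1, either r or r - 2 shares the factor 2 or 3 with h. For h = 6 the
-- residues 0, 2, 4 are even, while 3 and 5 - 2 are divisible by 3.
residue-one : ∀ {k p q p′ q′ x} → Rigid k → p * x + q * + suc k ≡ 1ℤ →
  p′ * (x - + 2) + q′ * + suc k ≡ 1ℤ → ∃[ m ] x ≡ 1ℤ + + suc k * m
residue-one {k} {p} {q} {p′} {q′} {x} rigid bez bez′ = classify rigid (x %ℕ suc k) (n%ℕd<d x (suc k)) refl
  where
  Residue : Set
  Residue = ∃[ m ] x ≡ 1ℤ + + suc k * m
  e = x /ℕ suc k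
  x≡ : ∀ {r} → x %ℕ suc k ≡ r → x ≡ + r + e * + suc k
  x≡ r≡ = trans (a≡a%ℕn+[a/ℕn]*n x (suc k)) (cong (λ z → + z + e * + suc k) r≡)
  one : ∀ {r} → x %ℕ suc k ≡ r → r ≡ 1 → Residue
  one r≡ refl = e , trans (x≡ r≡) (cong (λ z → 1ℤ + z) (ℤ.*-comm e (+ suc k)))
  shared : ∀ {r} d s t → x %ℕ suc k ≡ r → 1ℤ < d → + r ≡ d * s → + suc k ≡ d * t → Residue
  shared {r} d s t r≡ 1<d r-eq k-eq = ⊥-elim (common-divisor-absurd {p} {q} {s = s + e * t} {t} d 1<d
    (trans (x≡ r≡) (trans (cong₂ (λ a b → a + e * b) r-eq k-eq) (collect d s t e))) k-eq bez)
    where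
    collect : ∀ d s t e → d * s + e * (d * t) ≡ d * (s + e * t)
    collect = ℤ-Ring.solve-∀
  shared′ : ∀ {r} d s t → x %ℕ suc k ≡ r → 1ℤ < d → + r - + 2 ≡ d * s → + suc k ≡ d * t → Residue
  shared′ {r} d s t r≡ 1<d r-eq k-eq = ⊥-elim (common-divisor-absurd {p′} {q′} {s = s + e * t} {t} d 1<d
    (trans (cong (_- + 2) (x≡ r≡)) (trans (move (+ r) (e * + suc k)) (trans (cong₂ (λ a b → a + e * b) r-eq k-eq) (collect d s t e)))) k-eq bez′)
    where
    move : ∀ r z → r + z - + 2 ≡ r - + 2 + z
    move = ℤ-Ring.solve-∀
    collect : ∀ d s t e → d * s + e * (d * t) ≡ d * (s + e * t)
    collect = ℤ-Ring.solve-∀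
  classify : Rigid k → ∀ r → r ℕ.< suc k → x %ℕ suc k ≡ r → Residue
  classify _                  1 _ r≡ = one r≡ refl
  classify (inj₁ refl)        0 _ r≡ = shared (+ 2) (+ 0) (+ 1) r≡ 1<2 refl refl
  classify (inj₁ refl)        (suc (suc _)) (ℕ.s≤s (ℕ.s≤s ())) _
  classify (inj₂ (inj₁ refl)) 0 _ r≡ = shared (+ 3) (+ 0) (+ 1) r≡ 1<3 refl refl
  classify (inj₂ (inj₁ refl)) 2 _ r≡ = shared′ (+ 3) (+ 0) (+ 1) r≡ 1<3 refl refl
  classify (inj₂ (inj₁ refl)) (suc (suc (suc _))) (ℕ.s≤s (ℕ.s≤s (ℕ.s≤s ()))) _
  classify (inj₂ (inj₂ refl)) 0 _ r≡ = shared (+ 2) (+ 0) (+ 3) r≡ 1<2 refl refl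
  classify (inj₂ (inj₂ refl)) 2 _ r≡ = shared (+ 2) (+ 1) (+ 3) r≡ 1<2 refl refl
  classify (inj₂ (inj₂ refl)) 3 _ r≡ = shared (+ 3) (+ 1) (+ 2) r≡ 1<3 refl refl
  classify (inj₂ (inj₂ refl)) 4 _ r≡ = shared (+ 2) (+ 2) (+ 3) r≡ 1<2 refl refl
  classify (inj₂ (inj₂ refl)) 5 _ r≡ = shared′ (+ 3) (+ 1) (+ 2) r≡ 1<3 refl refl
  classify (inj₂ (inj₂ refl)) (suc (suc (suc (suc (suc (suc _)))))) (ℕ.s≤s (ℕ.s≤s (ℕ.s≤s (ℕ.s≤s (ℕ.s≤s (ℕ.s≤s ())))))) _

-- The height is not given: `inner-count` finds height - 1 interior points, and uniqueness of the
-- count identifies this number with k.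
collinear-211 : ∀ {k A B C} → Rigid k → 0ℤ < det A B C → Edge A B 2 → Edge B C 1 → Edge C A 1 →
  HasExactly k (Inner A B C) → Collinear (Inner A B C)
collinear-211 {k} {a₁ , a₂} {B} {c₁ , c₂} rigid 0<D (edge (v₁ , v₂) (u₁ , u₂) bez refl) e₂ e₃ exactly =
  conclude (height-suc 0<D)
  where
  open Frame a₁ a₂ c₁ c₂ v₁ v₂ u₁ u₂ bez hiding (A; B; C)
  conclude : ∃[ k′ ] height ≡ + suc k′ → Collinear (Inner (a₁ , a₂) B (c₁ , c₂))
  conclude (k′ , h≡) = inner-collinear m 0<D (trans x≡ (cong (λ z → 1ℤ + z * m) (sym h≡k)))
    where
    h≡k : height ≡ + suc k
    h≡k = trans h≡ (cong (λ z → + suc z) (hasExactly-unique {S = Inner (a₁ , a₂) B (c₁ , c₂)} (inner-count 0<D e₂ e₃ h≡) exactly))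
    bz = apex-bézout e₃
    bz′ = apex-bézout′ e₂
    res = residue-one {k} {proj₁ bz} {proj₁ (proj₂ bz)} {proj₁ bz′} {proj₁ (proj₂ bz′)} {apex} rigid
      (trans (cong (λ z → proj₁ bz * apex + proj₁ (proj₂ bz) * z) (sym h≡k)) (proj₂ (proj₂ bz)))
      (trans (cong (λ z → proj₁ bz′ * (apex - + 2) + proj₁ (proj₂ bz′) * z) (sym h≡k)) (proj₂ (proj₂ bz′)))
    m = proj₁ res
    x≡ : apex ≡ 1ℤ + + suc k * m
    x≡ = proj₂ res

-- Symmetries of the triangle and the position of its double edge

hull : Lattice → Lattice → Lattice → Pred Plane 0ℓ
hull A B C = Hull₃ (ι A) (ι B) (ι C)

inner-rotate : ∀ A B C P → Inner A B C P ⇔ Inner B C A P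
inner-rotate A B C P = mk⇔
  (interior-mono {hull A B C} {hull B C A} hull-rotate)
  (interior-mono {hull C A B} {hull A B C} hull-rotate ∘ interior-mono {hull B C A} {hull C A B} hull-rotate)

inner-swap : ∀ A B C P → Inner A B C P ⇔ Inner B A C P
inner-swap A B C P = mk⇔
  (interior-mono {hull A B C} {hull B A C} hull-swap)
  (interior-mono {hull B A C} {hull A B C} hull-swap)

boundary-swap : ∀ A B C P → Boundary A B C P ⇔ Boundary B A C P
boundary-swap A B C P = mk⇔ (swap A B C) (swap B A C)
  where
  swap : ∀ A B C → Boundary A B C P → Boundary B A C P
  swap A B C (inj₁ s) = inj₁ (segment-swap {ι A} {ι B} s)
  swap A B C (inj₂ (inj₁ s)) = inj₂ (inj₂ (segment-swap {ι B} {ι C} s))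
  swap A B C (inj₂ (inj₂ s)) = inj₂ (inj₁ (segment-swap {ι C} {ι A} s))

collinear-resp : ∀ {S T : Pred Lattice 0ℓ} → (∀ P → S P ⇔ T P) → Collinear T → Collinear S
collinear-resp S⇔T (ℓ , on) = ℓ , λ P SP → on P (to (S⇔T P) SP)

det-degenerate : ∀ A C → det A A C ≡ 0ℤ
det-degenerate (a₁ , a₂) (c₁ , c₂) = identity a₁ a₂ c₁ c₂
  where
  identity : ∀ a₁ a₂ c₁ c₂ → (a₁ - a₁) * (c₂ - a₂) - (a₂ - a₂) * (c₁ - a₁) ≡ 0ℤ
  identity = ℤ-Ring.solve-∀

det≢0⇒≢ : ∀ {A B C} → det A B C ≢ 0ℤ → A ≢ B
det≢0⇒≢ {A} {C = C} D≢0 refl = D≢0 (det-degenerate A C)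

det-swap : ∀ A B C → det B A C ≡ - det A B C
det-swap (a₁ , a₂) (b₁ , b₂) (c₁ , c₂) = identity a₁ a₂ b₁ b₂ c₁ c₂
  where
  identity : ∀ a₁ a₂ b₁ b₂ c₁ c₂ →
    (a₁ - b₁) * (c₂ - b₂) - (a₂ - b₂) * (c₁ - b₁) ≡ - ((b₁ - a₁) * (c₂ - a₂) - (b₂ - a₂) * (c₁ - a₁))
  identity = ℤ-Ring.solve-∀

-- The numbers of primitive steps on the edges add up to 4, so exactly one edge has a second step;
-- rotation makes it AB.
collinear-positive : ∀ {k A B C} → Rigid k → 0ℤ < det A B C →
  HasExactly 4 (Boundary A B C) → HasExactly k (Inner A B C) → Collinear (Inner A B C)
collinear-positive {k} {A} {B} {C} rigid 0<D boundary inner =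
  split (edge-exists A B (det≢0⇒≢ {C = C} D≢0))
        (edge-exists B C (det≢0⇒≢ {C = A} D′≢0))
        (edge-exists C A (det≢0⇒≢ {C = B} (det-rotate-≢0 B C A D′≢0)))
  where
  D≢0 : det A B C ≢ 0ℤ
  D≢0 D≡0 = ℤ.<-irrefl (sym D≡0) 0<D
  D′≢0 = det-rotate-≢0 A B C D≢0
  0<D′ = 0<-resp (det-rotate A B C) 0<D
  cases : ∀ f g h → f ℕ.+ (g ℕ.+ h) ≡ 1 →
    Edge A B (suc f) → Edge B C (suc g) → Edge C A (suc h) → Collinear (Inner A B C)
  cases 1 0 0 refl e₁ e₂ e₃ = collinear-211 {A = A} {B} {C} rigid 0<D e₁ e₂ e₃ inner
  cases 0 1 0 refl e₁ e₂ e₃ = collinear-resp {Inner A B C} {Inner B C A} (inner-rotate A B C)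
    (collinear-211 {A = B} {C} {A} rigid 0<D′ e₂ e₃ e₁
      (hasExactly-resp {S = Inner A B C} {Inner B C A} (inner-rotate A B C) inner))
  cases 0 0 1 refl e₁ e₂ e₃ = collinear-resp {Inner A B C} {Inner C A B} (λ P → ⇔-sym (inner-rotate C A B P))
    (collinear-211 {A = C} {A} {B} rigid (0<-resp (det-rotate B C A) 0<D′) e₃ e₁ e₂
      (hasExactly-resp {S = Inner A B C} {Inner C A B} (λ P → ⇔-sym (inner-rotate C A B P)) inner))
  cases 0 0 0 ()
  cases 0 0 (suc (suc _)) ()
  cases 0 1 (suc _) ()
  cases 0 (suc (suc _)) _ ()
  cases 1 0 (suc _) ()
  cases 1 (suc _) _ ()
  cases (suc (suc _)) _ _ ()
  excess : ∀ f g h → 3 ℕ.+ (f ℕ.+ (g ℕ.+ h)) ≡ (1 ℕ.+ f) ℕ.+ ((1 ℕ.+ g) ℕ.+ (1 ℕ.+ h))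
  excess = ℕ-Ring.solve-∀
  split : ∃[ f ] Edge A B (suc f) → ∃[ g ] Edge B C (suc g) → ∃[ h ] Edge C A (suc h) → Collinear (Inner A B C)
  split (f , e₁) (g , e₂) (h , e₃) =
    cases f g h (ℕ.+-cancelˡ-≡ 3 _ 1 (trans (excess f g h)
      (hasExactly-unique {S = Boundary A B C} (boundary-count D≢0 e₁ e₂ e₃) boundary))) e₁ e₂ e₃

all-collinear : ∀ {k} → Rigid k → ∀ T → HasCounts 4 k T → Collinear (InteriorPoint T)
all-collinear rigid T (boundary , inner) = orient (ℤ.<-cmp 0ℤ (det A B C))
  where
  open LatticeTriangle T
  orient : Tri (0ℤ < det A B C) (0ℤ ≡ det A B C) (det A B C < 0ℤ) → Collinear (Inner A B C)
  orient (tri< 0<D _ _) = collinear-positive {A = A} {B} {C} rigid 0<D boundary inner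
  orient (tri≈ _ 0≡D _) = ⊥-elim (nondegenerate (det≡0⇒collinear A B C (sym 0≡D)))
  orient (tri> _ _ D<0) = collinear-resp {Inner A B C} {Inner B A C} (inner-swap A B C)
    (collinear-positive {A = B} {A} {C} rigid (0<-resp (sym (det-swap A B C)) (ℤ.neg-mono-< D<0))
      (hasExactly-resp {S = Boundary A B C} {Boundary B A C} (boundary-swap A B C) boundary)
      (hasExactly-resp {S = Inner A B C} {Inner B A C} (inner-swap A B C) inner))

-- Triangles with a prescribed apex

module Standard (k : ℕ) (x p q p′ q′ : ℤ)
  (bez : p * x + q * + suc k ≡ 1ℤ) (bez′ : p′ * (x - + 2) + q′ * + suc k ≡ 1ℤ) where

  A B C : Lattice
  A = 0ℤ , 0ℤ
  B = + 2 , 0ℤ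
  C = x , + suc k

  private
    det≡ : det A B C ≡ + 2 * + suc k
    det≡ = identity x (+ suc k)
      where
      identity : ∀ x h → (+ 2 - 0ℤ) * (h - 0ℤ) - (0ℤ - 0ℤ) * (x - 0ℤ) ≡ + 2 * h
      identity = ℤ-Ring.solve-∀

  0<D : 0ℤ < det A B C
  0<D = 0<-resp (sym det≡) (ℤ.+<+ ℕ.z<s)

  private
    D≢0 : det A B C ≢ 0ℤ
    D≢0 D≡0 = ℤ.<-irrefl (sym D≡0) 0<D

  triangle : LatticeTriangle
  triangle = record { A = A; B = B; C = C; nondegenerate = det≢0⇒non-collinear {A} {B} {C} D≢0 }

  has-counts : HasCounts 4 k triangle
  has-counts =
    boundary-count {A} {B} {C} D≢0 (edge {g = 2} (1ℤ , 0ℤ) (1ℤ , 0ℤ) refl refl) e₂ e₃ ,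
    Frame.inner-count 0ℤ 0ℤ x (+ suc k) 1ℤ 0ℤ 1ℤ 0ℤ refl {k} 0<D e₂ e₃ (height≡ x (+ suc k))
    where
    end : ∀ a b → b ≡ a + + 1 * (b - a)
    end = ℤ-Ring.solve-∀
    end₀ : ∀ z → 0ℤ ≡ z + + 1 * (- z)
    end₀ = ℤ-Ring.solve-∀
    flip : ∀ p q x h → - p * - x + - q * - h ≡ p * x + q * h
    flip = ℤ-Ring.solve-∀
    e₂ : Edge B C 1
    e₂ = edge (x - + 2 , + suc k) (p′ , q′) bez′ (cong₂ _,_ (end (+ 2) x) (sym (trans (ℤ.+-identityˡ _) (ℤ.*-identityˡ (+ suc k)))))
    e₃ : Edge C A 1
    e₃ = edge (- x , - + suc k) (- p , - q) (trans (flip p q x (+ suc k)) bez) (cong₂ _,_ (end₀ x) (end₀ (+ suc k)))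
    height≡ : ∀ x h → 1ℤ * (h - 0ℤ) - 0ℤ * (x - 0ℤ) ≡ h
    height≡ = ℤ-Ring.solve-∀

-- The apex abscissa x = 1 suits every height, since x and x - 2 are the units 1 and -1.
four-boundary-triangle : ∀ k → Σ[ T ∈ LatticeTriangle ] HasCounts 4 k T
four-boundary-triangle k = Standard.triangle k 1ℤ 1ℤ 0ℤ (- 1ℤ) 0ℤ refl refl , Standard.has-counts k 1ℤ 1ℤ 0ℤ (- 1ℤ) 0ℤ refl refl

record Witness (h : ℤ) : Set where
  constructor witness
  field
    y s t  : ℤ
    1<y    : 0ℤ < y - 1ℤ
    y<h-1  : 0ℤ < h - 1ℤ - y
    bézout : s * (y * y - 1ℤ) + t * h ≡ 1ℤ

-- For such y the triangle with x = y + 1 contains (1,1), (2,1) and (2,2).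
witness⇒¬collinear : ∀ {k} → Witness (+ suc k) → ¬ BCollinear 4 k
witness⇒¬collinear {k} (witness y s t 1<y y<h-1 bez) (_ , all) =
  det≢0⇒non-collinear {P} {Q} {R} (λ ())
    -- The bounds on y come from two of these points: Q and the side BC need y > 1, P and the side
    -- CA need y < h - 1. The same two determinants, doubled, settle R.
    (ℓ , on P (inner P (ℤ.+<+ ℕ.z<s) (0<-resp (P₂ y h) (0<+ 0<h 1<y)) (0<-resp (P₃ y h) y<h-1))
       , on Q (inner Q (ℤ.+<+ ℕ.z<s) (0<-resp (Q₂ y h) 1<y) (0<-resp (Q₃ y h) (0<+ y<h-1 0<h)))
       , on R (inner R (ℤ.+<+ ℕ.z<s) (0<-resp (R₂ y h) (0<+ 1<y 1<y)) (0<-resp (R₃ y h) (0<+ y<h-1 y<h-1))))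
  where
  h = + suc k
  P Q R : Lattice
  P = 1ℤ , 1ℤ
  Q = + 2 , 1ℤ
  R = + 2 , + 2
  0<h : 0ℤ < h
  0<h = ℤ.+<+ ℕ.z<s
  split₁ : ∀ y s t h → s * (y - 1ℤ) * (y + 1ℤ) + t * h ≡ s * (y * y - 1ℤ) + t * h
  split₁ = ℤ-Ring.solve-∀
  split₂ : ∀ y s t h → s * (y + 1ℤ) * (y + 1ℤ - + 2) + t * h ≡ s * (y * y - 1ℤ) + t * h
  split₂ = ℤ-Ring.solve-∀
  -- Here x = y + 1 and x - 2 = y - 1 are the two factors of y² - 1; moving the other factor into
  -- the coefficient yields both Bézout relations.
  open Standard k (y + 1ℤ) (s * (y - 1ℤ)) t (s * (y + 1ℤ)) t (trans (split₁ y s t h) bez) (trans (split₂ y s t h) bez)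
  collinear : Collinear (InteriorPoint triangle)
  collinear = all triangle has-counts
  ℓ = proj₁ collinear
  on = proj₂ collinear
  inner : ∀ P → 0ℤ < det A B P → 0ℤ < det B C P → 0ℤ < det C A P → Inner A B C P
  inner P d₁ d₂ d₃ = from (interior⇔dets {A} {B} {C} 0<D P) (d₁ , d₂ , d₃)
  P₂ : ∀ y h → h + (y - 1ℤ) ≡ (y + 1ℤ - + 2) * (1ℤ - 0ℤ) - (h - 0ℤ) * (1ℤ - + 2)
  P₂ = ℤ-Ring.solve-∀
  P₃ : ∀ y h → h - 1ℤ - y ≡ (0ℤ - (y + 1ℤ)) * (1ℤ - h) - (0ℤ - h) * (1ℤ - (y + 1ℤ))
  P₃ = ℤ-Ring.solve-∀
  Q₂ : ∀ y h → y - 1ℤ ≡ (y + 1ℤ - + 2) * (1ℤ - 0ℤ) - (h - 0ℤ) * (+ 2 - + 2)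
  Q₂ = ℤ-Ring.solve-∀
  Q₃ : ∀ y h → h - 1ℤ - y + h ≡ (0ℤ - (y + 1ℤ)) * (1ℤ - h) - (0ℤ - h) * (+ 2 - (y + 1ℤ))
  Q₃ = ℤ-Ring.solve-∀
  R₂ : ∀ y h → y - 1ℤ + (y - 1ℤ) ≡ (y + 1ℤ - + 2) * (+ 2 - 0ℤ) - (h - 0ℤ) * (+ 2 - + 2)
  R₂ = ℤ-Ring.solve-∀
  R₃ : ∀ y h → h - 1ℤ - y + (h - 1ℤ - y) ≡ (0ℤ - (y + 1ℤ)) * (+ 2 - h) - (0ℤ - h) * (+ 2 - (y + 1ℤ))
  R₃ = ℤ-Ring.solve-∀

-- Choice of y in each residue class of h

linear : ∀ a b n → 0ℤ < + a * + n + + suc b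
linear a b n = subst (λ z → 0ℤ < z + + suc b) (ℤ.pos-* a n) (ℤ.+<+ (ℕ.≤-trans ℕ.z<s (ℕ.m≤n+m (suc b) (a ℕ.* n))))

-- In this and the next three families y = 2, and h differs by 1 from a multiple of 3 = y² - 1; the
-- multiplier and a unit are the coefficients, up to sign.
witness-7+6n : ∀ n → Witness (+ 6 * + n + + 7)
witness-7+6n n = witness (+ 2) (- (+ 2 * + n + + 2)) 1ℤ (ℤ.+<+ ℕ.z<s)
  (0<-resp (gap (+ n)) (linear 6 3 n)) (bezout (+ n))
  where
  gap : ∀ N → + 6 * N + + 4 ≡ + 6 * N + + 7 - 1ℤ - + 2
  gap = ℤ-Ring.solve-∀
  bezout : ∀ N → - (+ 2 * N + + 2) * (+ 2 * + 2 - 1ℤ) + 1ℤ * (+ 6 * N + + 7) ≡ 1ℤ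
  bezout = ℤ-Ring.solve-∀

witness-8+6n : ∀ n → Witness (+ 6 * + n + + 8)
witness-8+6n n = witness (+ 2) (+ 2 * + n + + 3) (- 1ℤ) (ℤ.+<+ ℕ.z<s)
  (0<-resp (gap (+ n)) (linear 6 4 n)) (bezout (+ n))
  where
  gap : ∀ N → + 6 * N + + 5 ≡ + 6 * N + + 8 - 1ℤ - + 2
  gap = ℤ-Ring.solve-∀
  bezout : ∀ N → (+ 2 * N + + 3) * (+ 2 * + 2 - 1ℤ) + (- 1ℤ) * (+ 6 * N + + 8) ≡ 1ℤ
  bezout = ℤ-Ring.solve-∀

witness-4+6n : ∀ n → Witness (+ 6 * + n + + 4)
witness-4+6n n = witness (+ 2) (- (+ 2 * + n + + 1)) 1ℤ (ℤ.+<+ ℕ.z<s)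
  (0<-resp (gap (+ n)) (linear 6 0 n)) (bezout (+ n))
  where
  gap : ∀ N → + 6 * N + + 1 ≡ + 6 * N + + 4 - 1ℤ - + 2
  gap = ℤ-Ring.solve-∀
  bezout : ∀ N → - (+ 2 * N + + 1) * (+ 2 * + 2 - 1ℤ) + 1ℤ * (+ 6 * N + + 4) ≡ 1ℤ
  bezout = ℤ-Ring.solve-∀

witness-5+6n : ∀ n → Witness (+ 6 * + n + + 5)
witness-5+6n n = witness (+ 2) (+ 2 * + n + + 2) (- 1ℤ) (ℤ.+<+ ℕ.z<s)
  (0<-resp (gap (+ n)) (linear 6 1 n)) (bezout (+ n))
  where
  gap : ∀ N → + 6 * N + + 2 ≡ + 6 * N + + 5 - 1ℤ - + 2
  gap = ℤ-Ring.solve-∀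
  bezout : ∀ N → (+ 2 * N + + 2) * (+ 2 * + 2 - 1ℤ) + (- 1ℤ) * (+ 6 * N + + 5) ≡ 1ℤ
  bezout = ℤ-Ring.solve-∀

-- With h = 2 j + 1, the relation is the expansion of (h − 2 j)³ = 1.
witness-9+6n : ∀ n → Witness (+ 6 * + n + + 9)
witness-9+6n n = witness (+ 3) (- (j * j * j)) (h * h - + 6 * h * j + + 12 * j * j) (ℤ.+<+ ℕ.z<s)
  (0<-resp (gap (+ n)) (linear 6 4 n)) (bezout (+ n))
  where
  h = + 6 * + n + + 9
  j = + 3 * + n + + 4
  gap : ∀ N → + 6 * N + + 5 ≡ + 6 * N + + 9 - 1ℤ - + 3
  gap = ℤ-Ring.solve-∀
  bezout : ∀ N → - ((+ 3 * N + + 4) * (+ 3 * N + + 4) * (+ 3 * N + + 4)) * (+ 3 * + 3 - 1ℤ) +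
    ((+ 6 * N + + 9) * (+ 6 * N + + 9) - + 6 * (+ 6 * N + + 9) * (+ 3 * N + + 4) + + 12 * (+ 3 * N + + 4) * (+ 3 * N + + 4)) *
    (+ 6 * N + + 9) ≡ 1ℤ
  bezout = ℤ-Ring.solve-∀

-- In the next two families h divides y².
witness-12+12n : ∀ n → Witness (+ 12 * + n + + 12)
witness-12+12n n = witness (+ 6 * + n + + 6) (- 1ℤ) (+ 3 * + n + + 3)
  (0<-resp (gap₁ (+ n)) (linear 6 4 n)) (0<-resp (gap₂ (+ n)) (linear 6 4 n)) (bezout (+ n))
  where
  gap₁ : ∀ N → + 6 * N + + 5 ≡ + 6 * N + + 6 - 1ℤ
  gap₁ = ℤ-Ring.solve-∀
  gap₂ : ∀ N → + 6 * N + + 5 ≡ + 12 * N + + 12 - 1ℤ - (+ 6 * N + + 6)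
  gap₂ = ℤ-Ring.solve-∀
  bezout : ∀ N → (- 1ℤ) * ((+ 6 * N + + 6) * (+ 6 * N + + 6) - 1ℤ) + (+ 3 * N + + 3) * (+ 12 * N + + 12) ≡ 1ℤ
  bezout = ℤ-Ring.solve-∀

witness-18+18n : ∀ n → Witness (+ 18 * + n + + 18)
witness-18+18n n = witness (+ 6 * + n + + 6) (- 1ℤ) (+ 2 * + n + + 2)
  (0<-resp (gap₁ (+ n)) (linear 6 4 n)) (0<-resp (gap₂ (+ n)) (linear 12 10 n)) (bezout (+ n))
  where
  gap₁ : ∀ N → + 6 * N + + 5 ≡ + 6 * N + + 6 - 1ℤ
  gap₁ = ℤ-Ring.solve-∀
  gap₂ : ∀ N → + 12 * N + + 11 ≡ + 18 * N + + 18 - 1ℤ - (+ 6 * N + + 6)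
  gap₂ = ℤ-Ring.solve-∀
  bezout : ∀ N → (- 1ℤ) * ((+ 6 * N + + 6) * (+ 6 * N + + 6) - 1ℤ) + (+ 2 * N + + 2) * (+ 18 * N + + 18) ≡ 1ℤ
  bezout = ℤ-Ring.solve-∀

-- In the next two families h = 36 w ± 6 and y = 12 w.  Then 9 = (2 ∓ 12 w) (± h) + 3 (y² − 1) by
-- Euclidean division in w, and 1 = 16 w² · 9 − (y² − 1).
witness-42+36n : ∀ n → Witness (+ 36 * + n + + 42)
witness-42+36n n = witness (+ 12 * w) (+ 48 * w * w - 1ℤ) (+ 16 * w * w * (+ 2 - + 12 * w))
  (0<-resp (gap₁ (+ n)) (linear 12 10 n)) (0<-resp (gap₂ (+ n)) (linear 24 28 n)) (bezout (+ n))
  where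
  w = + n + 1ℤ
  gap₁ : ∀ N → + 12 * N + + 11 ≡ + 12 * (N + 1ℤ) - 1ℤ
  gap₁ = ℤ-Ring.solve-∀
  gap₂ : ∀ N → + 24 * N + + 29 ≡ + 36 * N + + 42 - 1ℤ - + 12 * (N + 1ℤ)
  gap₂ = ℤ-Ring.solve-∀
  bezout : ∀ N → (+ 48 * (N + 1ℤ) * (N + 1ℤ) - 1ℤ) * (+ 12 * (N + 1ℤ) * (+ 12 * (N + 1ℤ)) - 1ℤ) +
    + 16 * (N + 1ℤ) * (N + 1ℤ) * (+ 2 - + 12 * (N + 1ℤ)) * (+ 36 * N + + 42) ≡ 1ℤ
  bezout = ℤ-Ring.solve-∀

witness-30+36n : ∀ n → Witness (+ 36 * + n + + 30)
witness-30+36n n = witness (+ 12 * w) (+ 48 * w * w - 1ℤ) (- (+ 16 * w * w * (+ 2 + + 12 * w)))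
  (0<-resp (gap₁ (+ n)) (linear 12 10 n)) (0<-resp (gap₂ (+ n)) (linear 24 16 n)) (bezout (+ n))
  where
  w = + n + 1ℤ
  gap₁ : ∀ N → + 12 * N + + 11 ≡ + 12 * (N + 1ℤ) - 1ℤ
  gap₁ = ℤ-Ring.solve-∀
  gap₂ : ∀ N → + 24 * N + + 17 ≡ + 36 * N + + 30 - 1ℤ - + 12 * (N + 1ℤ)
  gap₂ = ℤ-Ring.solve-∀
  bezout : ∀ N → (+ 48 * (N + 1ℤ) * (N + 1ℤ) - 1ℤ) * (+ 12 * (N + 1ℤ) * (+ 12 * (N + 1ℤ)) - 1ℤ) +
    - (+ 16 * (N + 1ℤ) * (N + 1ℤ) * (+ 2 + + 12 * (N + 1ℤ))) * (+ 36 * N + + 30) ≡ 1ℤ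
  bezout = ℤ-Ring.solve-∀

-- The residue of h = k + 1 modulo 6 decides unless h = 6 q; then q modulo 6 separates the multiples
-- of 12, the odd multiples of 18 and h ≡ ±6 modulo 36. The rigid heights 2, 3, 6 are the first
-- members of classes whose later members have witnesses, and h = 1 is excluded by k ≠ 0.
rigid-or-witness : ∀ k → .{{NonZero k}} → Rigid k ⊎ Witness (+ suc k)
rigid-or-witness k = classify (suc k divMod 6)
  where
  at : ∀ a n b → suc k ≡ a ℕ.* n ℕ.+ b → Witness (+ a * + n + + b) → Rigid k ⊎ Witness (+ suc k)
  at a n b eq w = inj₂ (subst Witness
    (sym (trans (cong +_ eq) (trans (ℤ.pos-+ (a ℕ.* n) b) (cong (λ z → z + + b) (ℤ.pos-* a n))))) w)
  six : ∀ {q r s} → suc k ≡ q ℕ.* 6 → q ≡ r → r ℕ.* 6 ≡ s → suc k ≡ s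
  six eq eq′ eq″ = trans eq (trans (cong (ℕ._* 6) eq′) eq″)
  multiple-of-six : ∀ q → suc k ≡ q ℕ.* 6 → DivMod q 6 → Rigid k ⊎ Witness (+ suc k)
  multiple-of-six q eq (result 0 0F eq′) = case six eq eq′ refl of λ ()
  multiple-of-six q eq (result (suc n) 0F eq′) =
    at 12 (3 ℕ.* n ℕ.+ 2) 12 (six eq eq′ (rearrange n)) (witness-12+12n (3 ℕ.* n ℕ.+ 2))
    where
    rearrange : ∀ n → (1 ℕ.+ n) ℕ.* 6 ℕ.* 6 ≡ 12 ℕ.* (3 ℕ.* n ℕ.+ 2) ℕ.+ 12
    rearrange = ℕ-Ring.solve-∀
  multiple-of-six q eq (result 0 1F eq′) = inj₁ (inj₂ (inj₂ (ℕ.suc-injective (six eq eq′ refl))))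
  multiple-of-six q eq (result (suc n) 1F eq′) =
    at 36 n 42 (six eq eq′ (rearrange n)) (witness-42+36n n)
    where
    rearrange : ∀ n → (1 ℕ.+ (1 ℕ.+ n) ℕ.* 6) ℕ.* 6 ≡ 36 ℕ.* n ℕ.+ 42
    rearrange = ℕ-Ring.solve-∀
  multiple-of-six q eq (result n 2F eq′) =
    at 12 (3 ℕ.* n) 12 (six eq eq′ (rearrange n)) (witness-12+12n (3 ℕ.* n))
    where
    rearrange : ∀ n → (2 ℕ.+ n ℕ.* 6) ℕ.* 6 ≡ 12 ℕ.* (3 ℕ.* n) ℕ.+ 12
    rearrange = ℕ-Ring.solve-∀
  multiple-of-six q eq (result n 3F eq′) =
    at 18 (2 ℕ.* n) 18 (six eq eq′ (rearrange n)) (witness-18+18n (2 ℕ.* n))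
    where
    rearrange : ∀ n → (3 ℕ.+ n ℕ.* 6) ℕ.* 6 ≡ 18 ℕ.* (2 ℕ.* n) ℕ.+ 18
    rearrange = ℕ-Ring.solve-∀
  multiple-of-six q eq (result n 4F eq′) =
    at 12 (3 ℕ.* n ℕ.+ 1) 12 (six eq eq′ (rearrange n)) (witness-12+12n (3 ℕ.* n ℕ.+ 1))
    where
    rearrange : ∀ n → (4 ℕ.+ n ℕ.* 6) ℕ.* 6 ≡ 12 ℕ.* (3 ℕ.* n ℕ.+ 1) ℕ.+ 12
    rearrange = ℕ-Ring.solve-∀
  multiple-of-six q eq (result n 5F eq′) =
    at 36 n 30 (six eq eq′ (rearrange n)) (witness-30+36n n)
    where
    rearrange : ∀ n → (5 ℕ.+ n ℕ.* 6) ℕ.* 6 ≡ 36 ℕ.* n ℕ.+ 30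
    rearrange = ℕ-Ring.solve-∀
  classify : DivMod (suc k) 6 → Rigid k ⊎ Witness (+ suc k)
  classify (result q 0F eq) = multiple-of-six q eq (q divMod 6)
  classify (result 0 1F eq) = ⊥-elim (ℕ.≢-nonZero⁻¹ k (ℕ.suc-injective eq))
  classify (result (suc n) 1F eq) = at 6 n 7 (trans eq (rearrange n)) (witness-7+6n n)
    where
    rearrange : ∀ n → 1 ℕ.+ (1 ℕ.+ n) ℕ.* 6 ≡ 6 ℕ.* n ℕ.+ 7
    rearrange = ℕ-Ring.solve-∀
  classify (result 0 2F eq) = inj₁ (inj₁ (ℕ.suc-injective eq))
  classify (result (suc n) 2F eq) = at 6 n 8 (trans eq (rearrange n)) (witness-8+6n n)
    where
    rearrange : ∀ n → 2 ℕ.+ (1 ℕ.+ n) ℕ.* 6 ≡ 6 ℕ.* n ℕ.+ 8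
    rearrange = ℕ-Ring.solve-∀
  classify (result 0 3F eq) = inj₁ (inj₂ (inj₁ (ℕ.suc-injective eq)))
  classify (result (suc n) 3F eq) = at 6 n 9 (trans eq (rearrange n)) (witness-9+6n n)
    where
    rearrange : ∀ n → 3 ℕ.+ (1 ℕ.+ n) ℕ.* 6 ≡ 6 ℕ.* n ℕ.+ 9
    rearrange = ℕ-Ring.solve-∀
  classify (result n 4F eq) = at 6 n 4 (trans eq (rearrange n)) (witness-4+6n n)
    where
    rearrange : ∀ n → 4 ℕ.+ n ℕ.* 6 ≡ 6 ℕ.* n ℕ.+ 4
    rearrange = ℕ-Ring.solve-∀
  classify (result n 5F eq) = at 6 n 5 (trans eq (rearrange n)) (witness-5+6n n)
    where
    rearrange : ∀ n → 5 ℕ.+ n ℕ.* 6 ≡ 6 ℕ.* n ℕ.+ 5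
    rearrange = ℕ-Ring.solve-∀

theorem1 : ∀ (k : ℕ) → .{{_ : NonZero k}} → BCollinear 4 k ⇔ (k ≡ 1 ⊎ k ≡ 2 ⊎ k ≡ 5)
theorem1 k = mk⇔
  (λ collinear → case rigid-or-witness k of λ
    { (inj₁ rigid) → rigid
    ; (inj₂ w) → ⊥-elim (witness⇒¬collinear w collinear) })
  (λ rigid → four-boundary-triangle k , all-collinear rigid)
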